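{- There is an absolute constant $c$ such that for every integer $k\ge 1$ there is $d_k$ (depending only on $k$) such that for every $n$ there exist randomized formulas $\mathbf F_{a,b}$, $a,b\in[n]$, each of depth at most $d_k$ and size at most $n^{\frac13\log_\varphi(k)+c}$, where $\varphi=(\sqrt5+1)/2$, which compute the product of $k$ permutation matrices: for every input $(Q_1,\dots,Q_k)$ of $n\times n$ permutation matrices and every $a,b\in[n]$, with probability $1-o(1)$ (as $n\to\infty$) $\mathbf F_{a,b}$ outputs the $(a,b)$ entry of $Q_1Q_2\cdots Q_k$.
   Context: Formulas are Boolean formulas over the basis of unbounded fan-in AND, unbounded fan-in OR, and NOT; size is the number of gates. The input $(Q_1,\dots,Q_k)$ is given as $kn^2$ Boolean variables (the entries of the matrices). A randomized formula is a probability distribution over formulas; its output on an input is a random bit. (In the paper's terminology these are "randomized $\mathsf{AC}^0$ formulas", i.e. of depth bounded independently of $n$.) -}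

module Defs where

open import Data.Nat using (ℕ; zero; suc; _+_; _*_; _∸_; _^_; _≤_; _<_)
open import Data.Bool using (Bool; true; false; not; _∧_; _∨_; if_then_else_)
open import Data.Fin using (Fin; zero; suc)
open import Data.Fin.Permutation using (Permutation′; _⟨$⟩ʳ_)
open import Data.List using (List; []; _∷_)
open import Data.List.NonEmpty using (List⁺; toList)
open import Data.Product using (_×_; _,_; ∃)
open import Data.Sum using (_⊎_)
open import Relation.Binary.PropositionalEquality using (_≡_)
open import Relation.Nullary.Decidable using (⌊_⌋)
import Data.Fin as F

data Formula (V : Set) : Set where
  var : V → Formula V
  ¬g  : Formula V → Formula V
  ∧g  : List (Formula V) → Formula V
  ∨g  : List (Formula V) → Formula V

max : ℕ → ℕ → ℕ
max zero n = n
max (suc m) zero = suc m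
max (suc m) (suc n) = suc (max m n)

mutual
  eval : {V : Set} → Formula V → (V → Bool) → Bool
  eval (var v) ρ = ρ v
  eval (¬g f) ρ = not (eval f ρ)
  eval (∧g fs) ρ = evalAnd fs ρ
  eval (∨g fs) ρ = evalOr fs ρ

  evalAnd : {V : Set} → List (Formula V) → (V → Bool) → Bool
  evalAnd [] ρ = true
  evalAnd (f ∷ fs) ρ = eval f ρ ∧ evalAnd fs ρ

  evalOr : {V : Set} → List (Formula V) → (V → Bool) → Bool
  evalOr [] ρ = false
  evalOr (f ∷ fs) ρ = eval f ρ ∨ evalOr fs ρ

mutual
  size : {V : Set} → Formula V → ℕ
  size (var v) = 0
  size (¬g f) = suc (size f)
  size (∧g fs) = suc (sizes fs)
  size (∨g fs) = suc (sizes fs)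

  sizes : {V : Set} → List (Formula V) → ℕ
  sizes [] = 0
  sizes (f ∷ fs) = size f + sizes fs

mutual
  depth : {V : Set} → Formula V → ℕ
  depth (var v) = 0
  depth (¬g f) = suc (depth f)
  depth (∧g fs) = suc (depths fs)
  depth (∨g fs) = suc (depths fs)

  depths : {V : Set} → List (Formula V) → ℕ
  depths [] = 0
  depths (f ∷ fs) = max (depth f) (depths fs)

-- Randomized formulas: a probability distribution over formulas, given
-- as a nonempty finite list (uniform over the list, multiplicities
-- allowed, hence arbitrary rational probabilities).

RandFormula : Set → Set
RandFormula V = List⁺ (Formula V)

AllIn : {V : Set} → (Formula V → Set) → RandFormula V → Set
AllIn {V} P F = go (toList F)
  where
  go : List (Formula V) → Set
  go [] = ⊤′
    where open import Data.Unit using () renaming (⊤ to ⊤′)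
  go (f ∷ fs) = P f × go fs

-- number of formulas in the support that output a bit different from b
-- (the probability of error is errCount / length)
errCount : {V : Set} → RandFormula V → (V → Bool) → Bool → ℕ
errCount {V} F ρ b = go (toList F)
  where
  go : List (Formula V) → ℕ
  go [] = 0
  go (f ∷ fs) = (if ⌊ eval f ρ Data.Bool.≟ b ⌋ then 0 else 1) + go fs
    where import Data.Bool

BMat : ℕ → Set
BMat n = Fin n → Fin n → Bool

NMat : ℕ → Set
NMat n = Fin n → Fin n → ℕ

IsPermMatrix : {n : ℕ} → BMat n → Set
IsPermMatrix {n} Q = ∃ λ (π : Permutation′ n) →
  ∀ i j → Q i j ≡ ⌊ (π ⟨$⟩ʳ i) F.≟ j ⌋

b2n : Bool → ℕ
b2n true = 1
b2n false = 0

sumFin : (n : ℕ) → (Fin n → ℕ) → ℕ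
sumFin zero f = 0
sumFin (suc n) f = f zero + sumFin n (λ i → f (suc i))

idMat : (n : ℕ) → NMat n
idMat n i j = b2n ⌊ i F.≟ j ⌋

_⊗_ : {n : ℕ} → NMat n → NMat n → NMat n
_⊗_ {n} A B i j = sumFin n (λ l → A i l * B l j)

prodMats : {n : ℕ} (k : ℕ) → (Fin k → BMat n) → NMat n
prodMats {n} zero Q = idMat n
prodMats (suc k) Q = (λ i j → b2n (Q zero i j)) ⊗ prodMats k (λ t → Q (suc t))

-- φ = (1+√5)/2.  φ^p = (L p + F p · √5)/2 with Lucas numbers L and
-- Fibonacci numbers F.

fib : ℕ → ℕ
fib zero = 0
fib (suc zero) = 1
fib (suc (suc p)) = fib (suc p) + fib p

lucas : ℕ → ℕ
lucas zero = 2
lucas (suc zero) = 1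
lucas (suc (suc p)) = lucas (suc p) + lucas p

-- φ^p > K  ⇔  L_p + F_p √5 > 2K
PhiPowGt : ℕ → ℕ → Set
PhiPowGt p K =
  (2 * K < lucas p) ⊎
  ((lucas p ≤ 2 * K) × ((2 * K ∸ lucas p) ^ 2 < 5 * fib p ^ 2))

-- s ≤ n ^ ((1/3) log_φ k + c), expressed via rational upper
-- approximations p/q > log_φ k (i.e. φ^p > k^q):
--   s^(3q) ≤ n^(p + 3cq)   for all such p, q ≥ 1.
SizeBound : (c k n s : ℕ) → Set
SizeBound c k n s =
  ∀ p q → 1 ≤ q → PhiPowGt p (k ^ q) → s ^ (3 * q) ≤ n ^ (p + 3 * c * q)

inputOf : {k n : ℕ} → (Fin k → BMat n) → (Fin k × Fin n × Fin n → Bool)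
inputOf Q (t , i , j) = Q t i j

productEntry : {n : ℕ} (k : ℕ) → (Fin k → BMat n) → Fin n → Fin n → Bool
productEntry k Q a b = prodMats k Q a b Data.Nat.≡ᵇ 1
  where import Data.Nat

{-# OPTIONS --safe #-}

-- Pad to L = F (t + 3) ≥ k layers by identities and hash the vertices of every layer at random into
-- r ≈ n ^ (1/3 + ε) classes. Three constraints "the path has hash x at layer i" at distinct layers
-- leave about n / r³ = o(1) other paths, so such a triple of constraints isolates a fixed path with
-- probability 1 − o(1). Two triples on p₁ < p₂ < p₃ and p₂ < p₃ < p₄ that single out the same path are
-- joined, by guessing only the hash value at p₂ (or at p₃), into a triple that omits p₂ (or p₃).
-- With Fibonacci gaps each such join costs a factor r and lengthens the path by a factor φ, whence
-- t ≈ log_φ k joins and size n ^ (t / 3 + O(1)).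
-- Paths are compared digit by digit in base D = n ^ ε, where ε depends only on k.

module Submission where

open import Defs
open import Data.Nat using (ℕ; zero; suc; _+_; _*_; _∸_; _^_; _≤_; _<_; z≤n; s≤s; _<?_; >-nonZero)
import Data.Nat as ℕ
open import Data.Nat.Properties
open import Data.Nat.Solver using (module +-*-Solver)
open import Data.Bool using (Bool; true; false; _∧_; if_then_else_)
import Data.Bool as Bool
open import Data.Fin using (Fin; zero; suc; toℕ; fromℕ<; inject≤; finToFun; funToFin; combine)
import Data.Fin as F
open import Data.Fin.Permutation using (Permutation′; _⟨$⟩ʳ_; _⟨$⟩ˡ_; _∘ₚ_; inverseˡ; inverseʳ) renaming (id to idₚ)
open import Data.Fin.Properties using (toℕ<n; toℕ-injective; inject≤-injective; funToFin-finToFin)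
open import Data.Product using (_×_; _,_; ∃; proj₁; proj₂)
open import Data.Sum using (inj₁; inj₂)
open import Data.Empty using (⊥-elim)
open import Data.Unit using (tt)
open import Data.List using (List; []; _∷_; length; map; tabulate; allFin; _++_; cartesianProductWith)
open import Data.List.Properties using (length-tabulate; length-map)
open import Data.List.NonEmpty using (toList) renaming (_∷_ to _∷⁺_)
open import Data.List.Relation.Unary.All using (All; []; _∷_)
import Data.List.Relation.Unary.All as All
open import Data.List.Relation.Unary.All.Properties using (tabulate⁺; map⁺)
open import Relation.Binary.Definitions using (tri<; tri≈; tri>)
open import Relation.Binary.PropositionalEquality using (_≡_; _≢_; refl; sym; trans; cong; cong₂; subst; module ≡-Reasoning)
open import Relation.Nullary using (¬_; Dec; yes; no; contradiction)
open import Relation.Nullary.Decidable using (⌊_⌋; _×-dec_; ¬?)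
open import Relation.Nullary.Reflects using (Reflects; ofʸ; ofⁿ; ¬-reflects; _×-reflects_; _⊎-reflects_; det)
open import Function using (_∘_)

-- A node cannot simply pass a path upward: three hash constraints may fit several paths, or none.
-- Every join is therefore certified by `match`, which accepts only if both sides hold exactly one
-- path and it is the same one. On permutation matrices an output 1 is thus right under every hash,
-- and errors are only missed paths. Uniqueness is not monotone in the constraints, so the analysis
-- fixes the path from the start vertex and asks that no other path share its hashes at any three
-- layers (`Isolated`). One union bound then serves all nodes at once. Comparing the vertices of two
-- children by an OR over all n vertices would cost a factor n per join. Comparing K digits in base
-- D costs K D² instead, with D ^ K close to n and K depending only on k. With K = 3 (t + 1) and r =
-- D ^ (t + 2), r³ = D ^ (K + 3) exceeds n by a factor D³, and this surplus drives the error to 0.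

private variable
  V A A′ : Set

-- Formula gadgets: semantics, size and depth

reflects-map : ∀ {A B : Set} {b} → (A → B) → (B → A) → Reflects A b → Reflects B b
reflects-map f g (ofʸ a) = ofʸ (f a)
reflects-map f g (ofⁿ ¬a) = ofⁿ (¬a ∘ g)

isYes-reflects : ∀ {A : Set} (a? : Dec A) → Reflects A ⌊ a? ⌋
isYes-reflects (yes a) = ofʸ a
isYes-reflects (no ¬a) = ofⁿ ¬a

max≤ : ∀ {m n d} → m ≤ d → n ≤ d → max m n ≤ d
max≤ {zero} p q = q
max≤ {suc m} {zero} p q = p
max≤ {suc m} {suc n} (s≤s p) (s≤s q) = s≤s (max≤ p q)

depths≤ : ∀ {d} {fs : List (Formula V)} → All (λ f → depth f ≤ d) fs → depths fs ≤ d
depths≤ [] = z≤n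
depths≤ (p ∷ ps) = max≤ p (depths≤ ps)

sizes≤ : ∀ {b} {fs : List (Formula V)} → All (λ f → size f ≤ b) fs → sizes fs ≤ length fs * b
sizes≤ [] = z≤n
sizes≤ (p ∷ ps) = +-mono-≤ p (sizes≤ ps)

evalOr-tabulate : ∀ {n} {P : Fin n → Set} {f : Fin n → Formula V} {ρ} →
  (∀ i → Reflects (P i) (eval (f i) ρ)) → Reflects (∃ P) (evalOr (tabulate f) ρ)
evalOr-tabulate {n = zero} r = ofⁿ λ ()
evalOr-tabulate {n = suc n} r = reflects-map
  (λ { (inj₁ p) → zero , p ; (inj₂ (i , p)) → suc i , p })
  (λ { (zero , p) → inj₁ p ; (suc i , p) → inj₂ (i , p) })
  (r zero ⊎-reflects evalOr-tabulate (r ∘ suc))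

evalAnd-tabulate : ∀ {n} {P : Fin n → Set} {f : Fin n → Formula V} {ρ} →
  (∀ i → Reflects (P i) (eval (f i) ρ)) → Reflects (∀ i → P i) (evalAnd (tabulate f) ρ)
evalAnd-tabulate {n = zero} r = ofʸ λ ()
evalAnd-tabulate {n = suc n} r = reflects-map
  (λ { (p , q) zero → p ; (p , q) (suc i) → q i })
  (λ p → p zero , p ∘ suc)
  (r zero ×-reflects evalAnd-tabulate (r ∘ suc))

⋁ ⋀ : ∀ {n} → (Fin n → Formula V) → Formula V
⋁ f = ∨g (tabulate f)
⋀ f = ∧g (tabulate f)

infixr 6 _∧ᶠ_
_∧ᶠ_ : Formula V → Formula V → Formula V
f ∧ᶠ g = ∧g (f ∷ g ∷ [])

-- The equivalence of `f` with a hardwired bit, at the price of at most one gate.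
lit : Bool → Formula V → Formula V
lit true f = f
lit false f = ¬g f

constᶠ : Bool → Formula V
constᶠ true = ∧g []
constᶠ false = ∨g []

∧ᶠ-reflects : ∀ {A B : Set} {f g : Formula V} {ρ} →
  Reflects A (eval f ρ) → Reflects B (eval g ρ) → Reflects (A × B) (eval (f ∧ᶠ g) ρ)
∧ᶠ-reflects {f = f} {g} {ρ} a b = go (eval f ρ) (eval g ρ) a b
  where
  -- The evaluation ends in `∧ true`, which reduces only once the second value is known.
  go : ∀ x y → Reflects _ x → Reflects _ y → Reflects _ (x ∧ (y ∧ true))
  go x true a b = a ×-reflects b
  go x false a b = a ×-reflects b

constᶠ-reflects : ∀ {A : Set} {b} {ρ : V → Bool} → Reflects A b → Reflects A (eval (constᶠ b) ρ)
constᶠ-reflects (ofʸ a) = ofʸ a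
constᶠ-reflects (ofⁿ ¬a) = ofⁿ ¬a

lit-reflects : ∀ {A B : Set} {b} {f : Formula V} {ρ} → Reflects A b → Reflects B (eval f ρ) →
  Reflects ((A → B) × (B → A)) (eval (lit b f) ρ)
lit-reflects (ofʸ a) = reflects-map (λ b → (λ _ → b) , λ _ → a) (λ p → proj₁ p a)
lit-reflects (ofⁿ ¬a) = reflects-map (λ ¬b → (⊥-elim ∘ ¬a) , ⊥-elim ∘ ¬b) (λ p b → ¬a (proj₂ p b)) ∘ ¬-reflects

⋁-size : ∀ {n b} {f : Fin n → Formula V} → (∀ i → size (f i) ≤ b) → size (⋁ f) ≤ suc (n * b)
⋁-size {b = b} {f} p =
  s≤s (subst (λ l → sizes (tabulate f) ≤ l * b) (length-tabulate f) (sizes≤ (tabulate⁺ p)))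

⋀-size : ∀ {n b} {f : Fin n → Formula V} → (∀ i → size (f i) ≤ b) → size (⋀ f) ≤ suc (n * b)
⋀-size {f = f} = ⋁-size {f = f}

⋁-depth : ∀ {n d} {f : Fin n → Formula V} → (∀ i → depth (f i) ≤ d) → depth (⋁ f) ≤ suc d
⋁-depth p = s≤s (depths≤ (tabulate⁺ p))

⋀-depth : ∀ {n d} {f : Fin n → Formula V} → (∀ i → depth (f i) ≤ d) → depth (⋀ f) ≤ suc d
⋀-depth {f = f} = ⋁-depth {f = f}

∧ᶠ-size : ∀ {a b} (f g : Formula V) → size f ≤ a → size g ≤ b → size (f ∧ᶠ g) ≤ suc (a + b)
∧ᶠ-size f g p q = s≤s (+-mono-≤ p (≤-trans (≤-reflexive (+-identityʳ (size g))) q))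

∧ᶠ-depth : ∀ {d} (f g : Formula V) → depth f ≤ d → depth g ≤ d → depth (f ∧ᶠ g) ≤ suc d
∧ᶠ-depth f g p q = s≤s (max≤ p (max≤ q z≤n))

lit-size : ∀ b (f : Formula V) → size (lit b f) ≤ suc (size f)
lit-size true f = n≤1+n _
lit-size false f = ≤-refl

lit-depth : ∀ b (f : Formula V) → depth (lit b f) ≤ suc (depth f)
lit-depth true f = n≤1+n _
lit-depth false f = ≤-refl

constᶠ-size : ∀ b → size {V} (constᶠ b) ≡ 1
constᶠ-size true = refl
constᶠ-size false = refl

constᶠ-depth : ∀ b → depth {V} (constᶠ b) ≡ 1
constᶠ-depth true = refl
constᶠ-depth false = refl

-- Recognising a common singleton by its digits

Only : {A : Set} → (A → Set) → A → Set
Only S u = S u × (∀ v → S v → v ≡ u)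

-- The digit sets of X and Y at position s are the same singleton, for every s.
match : ∀ {K D} (X Y : Fin K → Fin D → Formula V) → Formula V
match X Y = ⋀ λ s → ⋁ λ c → ⋀ λ c′ →
  lit ⌊ c F.≟ c′ ⌋ (X s c′) ∧ᶠ lit ⌊ c F.≟ c′ ⌋ (Y s c′)

module _ {n K D : ℕ} (s₀ : Fin K) (code : Fin n → Fin K → Fin D)
         (code-injective : ∀ u v → (∀ s → code u s ≡ code v s) → u ≡ v)
         {U : Set} (g : U → Fin n) (g-injective : ∀ u v → g u ≡ g v → u ≡ v)
         {ρ : V → Bool} where

  -- A set of paths is represented only through the digits that its members have at each position.
  -- This forgets which digits belong together, but loses nothing for a singleton.
  Digits : (U → Set) → (Fin K → Fin D → Formula V) → Set
  Digits S X = ∀ s c → Reflects (∃ λ u → S u × code (g u) s ≡ c) (eval (X s c) ρ)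

  -- If every position carries a single digit, two members agree in all digits and are equal by
  -- injectivity of `code` and `g`. Equal digits on both sides identify the two singletons.
  match-reflects : ∀ {S T X Y} → Digits S X → Digits T Y →
    Reflects (∃ λ u → Only S u × Only T u) (eval (match X Y) ρ)
  match-reflects {S} {T} {X} {Y} dX dY = reflects-map fwd bwd
    (evalAnd-tabulate {f = λ s → ⋁ λ c → ⋀ λ c′ → cell s c c′} λ s →
     evalOr-tabulate {f = λ c → ⋀ λ c′ → cell s c c′} λ c →
     evalAnd-tabulate {f = cell s c} λ c′ →
       ∧ᶠ-reflects {f = lit ⌊ c F.≟ c′ ⌋ (X s c′)} {g = lit ⌊ c F.≟ c′ ⌋ (Y s c′)}
       (lit-reflects {f = X s c′} (isYes-reflects (c F.≟ c′)) (dX s c′))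
       (lit-reflects {f = Y s c′} (isYes-reflects (c F.≟ c′)) (dY s c′)))
    where
    cell : Fin K → Fin D → Fin D → Formula V
    cell s c c′ = lit ⌊ c F.≟ c′ ⌋ (X s c′) ∧ᶠ lit ⌊ c F.≟ c′ ⌋ (Y s c′)
    Cell : (U → Set) → Fin K → Fin D → Fin D → Set
    Cell S s c c′ = (c ≡ c′ → ∃ λ u → S u × code (g u) s ≡ c′)
                  × ((∃ λ u → S u × code (g u) s ≡ c′) → c ≡ c′)
    fwd : (∀ s → ∃ λ c → ∀ c′ → Cell S s c c′ × Cell T s c c′) → ∃ λ u → Only S u × Only T u
    fwd p = u , (Su , λ v Sv → same v u (onlyS v Sv) (onlyS u Su))
              , subst T (sym u≡u′) Tu′ , λ v Tv → same v u (onlyT v Tv) (onlyS u Su)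
      where
      onlyS : ∀ v → S v → ∀ s → proj₁ (p s) ≡ code (g v) s
      onlyS v Sv s = proj₂ (proj₁ (proj₂ (p s) _)) (v , Sv , refl)
      onlyT : ∀ v → T v → ∀ s → proj₁ (p s) ≡ code (g v) s
      onlyT v Tv s = proj₂ (proj₂ (proj₂ (p s) _)) (v , Tv , refl)
      same : ∀ v w → (∀ s → proj₁ (p s) ≡ code (g v) s) → (∀ s → proj₁ (p s) ≡ code (g w) s) → v ≡ w
      same v w e e′ = g-injective v w (code-injective _ _ λ s → trans (sym (e s)) (e′ s))
      -- One position suffices to produce a member; without `s₀` the test would accept empty sets
      -- vacuously when K = 0.
      inS = proj₁ (proj₁ (proj₂ (p s₀) _)) refl
      inT = proj₁ (proj₂ (proj₂ (p s₀) _)) refl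
      u = proj₁ inS
      Su = proj₁ (proj₂ inS)
      Tu′ = proj₁ (proj₂ inT)
      u≡u′ : u ≡ proj₁ inT
      u≡u′ = same u (proj₁ inT) (onlyS _ Su) (onlyT _ Tu′)
    cell-of : ∀ {S u} → Only S u → ∀ s c′ → Cell S s (code (g u) s) c′
    cell-of {u = u} (Su , only) s c′ =
      (λ e → u , Su , e) , λ { (v , Sv , e) → trans (cong (λ w → code (g w) s) (sym (only v Sv))) e }
    bwd : (∃ λ u → Only S u × Only T u) → ∀ s → ∃ λ c → ∀ c′ → Cell S s c c′ × Cell T s c c′
    bwd (u , oS , oT) s = code (g u) s , λ c′ → cell-of oS s c′ , cell-of oT s c′

match-size : ∀ {K D z} (X Y : Fin K → Fin D → Formula V) →
  (∀ s c → size (X s c) ≤ z) → (∀ s c → size (Y s c) ≤ z) →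
  size (match X Y) ≤ suc (K * suc (D * suc (D * suc (suc z + suc z))))
match-size X Y pX pY =
  ⋀-size {f = λ s → ⋁ λ c → ⋀ λ c′ → _} λ s → ⋁-size {f = λ c → ⋀ λ c′ → _} λ c →
  ⋀-size {f = λ c′ → _} λ c′ → ∧ᶠ-size (lit ⌊ c F.≟ c′ ⌋ (X s c′)) (lit ⌊ c F.≟ c′ ⌋ (Y s c′))
    (≤-trans (lit-size _ (X s c′)) (s≤s (pX s c′))) (≤-trans (lit-size _ (Y s c′)) (s≤s (pY s c′)))

match-depth : ∀ {K D d} (X Y : Fin K → Fin D → Formula V) →
  (∀ s c → depth (X s c) ≤ d) → (∀ s c → depth (Y s c) ≤ d) →
  depth (match X Y) ≤ 5 + d
match-depth X Y pX pY =
  ⋀-depth {f = λ s → ⋁ λ c → ⋀ λ c′ → _} λ s → ⋁-depth {f = λ c → ⋀ λ c′ → _} λ c →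
  ⋀-depth {f = λ c′ → _} λ c′ → ∧ᶠ-depth (lit ⌊ c F.≟ c′ ⌋ (X s c′)) (lit ⌊ c F.≟ c′ ⌋ (Y s c′))
    (≤-trans (lit-depth _ (X s c′)) (s≤s (pX s c′))) (≤-trans (lit-depth _ (Y s c′)) (s≤s (pY s c′)))

-- Fibonacci layout and the recursive formulas

data Side : Set where
  fwd rev : Side

data Point : Set where
  left mid right : Point

triple : {A : Set} → A → A → A → Point → A
triple x y z left = x
triple x y z mid = y
triple x y z right = z

fib-pos : ∀ t → 1 ≤ fib (suc t)
fib-pos zero = ≤-refl
fib-pos (suc t) = ≤-trans (fib-pos t) (m≤m+n _ _)

-- Both sides span F (t + 3) layers. A `fwd` triple has the gaps F (t + 2), F (t + 1), a `rev`
-- triple the same gaps in reverse order; at level 0 the two coincide.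
layer : ℕ → Side → ℕ → Point → ℕ
layer t o p left = p
layer t fwd p mid = fib (2 + t) + p
layer t rev p mid = fib (1 + t) + p
layer t o p right = fib (3 + t) + p

-- A node of level t + 1 spans four layers p₁ < p₂ < p₃ < p₄ with gaps F (t + 2), F (t + 1), F (t + 2).
-- It is the union of a fwd node on p₁, p₂, p₃ and a rev node on p₂, p₃, p₄; a fwd node carries
-- constraints at p₁, p₃, p₄ and guesses the hash value w at p₂, a rev node carries constraints at
-- p₁, p₂, p₄ and guesses w at p₃.
lower upper : {A : Set} → Side → (Point → A) → A → Point → A
lower fwd a w = triple (a left) w (a mid)
lower rev a w = triple (a left) (a mid) w
upper fwd a w = triple w (a mid) (a right)
upper rev a w = triple (a mid) w (a right)

-- A child having the requested layer among its own three. An outer end lies in one child only; the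
-- retained inner layer lies in both and is read from the `fwd` child.
child : Side → Point → Side × Point
child o left = fwd , left
child fwd mid = fwd , right
child rev mid = fwd , mid
child o right = rev , right

choose : {A : Set} → (Point → A) → (Point → A) → Side × Point → A
choose b c (fwd , e) = b e
choose b c (rev , e) = c e

-- An index `u` stands for the path whose vertex at layer i is `pos i ⟨$⟩ʳ u`. All triples of layers
-- are covered, so the condition does not refer to the recursion.
Isolated : ∀ {n r} → (ℕ → Fin n → Fin r) → (ℕ → Permutation′ n) → ℕ → Fin n → Set
Isolated h pos L u = ∀ i j l → i < j → j < l → l ≤ L → ∀ v →
  collide i v → collide j v → collide l v → v ≡ u
  where
  collide : ℕ → _ → Set
  collide i v = h i (pos i ⟨$⟩ʳ v) ≡ h i (pos i ⟨$⟩ʳ u)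

module Construction {V : Set} {n r K D : ℕ} (code : Fin n → Fin K → Fin D)
         (edge : ℕ → Fin n → Fin n → Formula V) (h : ℕ → Fin n → Fin r) where

  -- Once the hash is drawn, all tests of hashes and digits are hardwired constants; only the two
  -- edges depend on the input.
  base : ℕ → (Point → Fin r) → Point → Fin K → Fin D → Formula V
  base p a e s c = ⋁ λ x → ⋁ λ y → ⋁ λ z →
    constᶠ ⌊ h p x F.≟ a left ×-dec h (1 + p) y F.≟ a mid ×-dec h (2 + p) z F.≟ a right
             ×-dec code (triple x y z e) s F.≟ c ⌋
    ∧ᶠ edge p x y ∧ᶠ edge (1 + p) y z

  -- The certificate `match` does not depend on the requested digit, yet it is repeated in every
  -- output bit because a formula cannot share gates. A guess `w` without a certificate contributes
  -- no digit.
  node : ℕ → Side → ℕ → (Point → Fin r) → Point → Fin K → Fin D → Formula V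
  node zero o p a e s c = base p a e s c
  node (suc t) o p a e s c = ⋁ λ w → match (B w right) (C w mid) ∧ᶠ choose (B w) (C w) (child o e) s c
    where
    B C : Fin r → Point → Fin K → Fin D → Formula V
    B w = node t fwd p (lower o a w)
    C w = node t rev (fib (2 + t) + p) (upper o a w)

  -- The two matches against hardwired singletons pin the unique path of the node to `a` at the
  -- first layer and to `b` at the last.
  root : ℕ → Fin n → Fin n → Formula V
  root t a b = ⋁ λ y →
    match (node t fwd 0 (ends y) left) (λ s c → constᶠ ⌊ code a s F.≟ c ⌋)
    ∧ᶠ match (node t fwd 0 (ends y) right) (λ s c → constᶠ ⌊ code b s F.≟ c ⌋)
    where
    ends : Fin r → Point → Fin r
    ends y = triple (h 0 a) y (h (fib (3 + t) + 0) b)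

  -- Correctness for a fixed hash

  module Semantics (s₀ : Fin K) (code-injective : ∀ u v → (∀ s → code u s ≡ code v s) → u ≡ v)
           {ρ : V → Bool} (pos : ℕ → Permutation′ n)
           (edge-reflects : ∀ i u v →
             Reflects (v ≡ pos (suc i) ⟨$⟩ʳ u) (eval (edge i (pos i ⟨$⟩ʳ u) v) ρ)) where

    at : ℕ → Fin n → Fin n
    at i u = pos i ⟨$⟩ʳ u

    at-injective : ∀ i u v → at i u ≡ at i v → u ≡ v
    at-injective i u v e = trans (sym (inverseˡ (pos i))) (trans (cong (pos i ⟨$⟩ˡ_) e) (inverseˡ (pos i)))

    -- Exactly what a node computes, for good and bad hashes alike. It always lies inside `Hashed`,
    -- and it reduces to one path when some isolated path satisfies the constraints.
    Mem : ℕ → Side → ℕ → (Point → Fin r) → Fin n → Set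
    Mem zero o p a u = ∀ e → h (layer 0 o p e) (at (layer 0 o p e) u) ≡ a e
    Mem (suc t) o p a u = ∃ λ w →
      Only (Mem t fwd p (lower o a w)) u × Only (Mem t rev (fib (2 + t) + p) (upper o a w)) u

    upper-mid : ∀ t p → layer t rev (fib (2 + t) + p) mid ≡ layer t fwd p right
    upper-mid t p = trans (sym (+-assoc (fib (1 + t)) (fib (2 + t)) p))
      (cong (_+ p) (+-comm (fib (1 + t)) (fib (2 + t))))

    upper-right : ∀ t o p → layer t rev (fib (2 + t) + p) right ≡ layer (suc t) o p right
    upper-right t o p = sym (+-assoc (fib (3 + t)) (fib (2 + t)) p)

    Hashed : (Point → ℕ) → (Point → Fin r) → Fin n → Set
    Hashed l a u = ∀ e → h (l e) (at (l e) u) ≡ a e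

    transport : ∀ {i j u x} → i ≡ j → h i (at i u) ≡ x → h j (at j u) ≡ x
    transport refl p = p

    -- Holds without isolation: each outer constraint is also a constraint of a child containing the
    -- path.
    mem⇒hashed : ∀ t o p a u → Mem t o p a u → Hashed (layer t o p) a u
    mem⇒hashed zero o p a u m = m
    mem⇒hashed (suc t) o p a u (w , (B , _) , (C , _)) = go o B C
      where
      go : ∀ o → Mem t fwd p (lower o a w) u → Mem t rev (fib (2 + t) + p) (upper o a w) u →
           Hashed (layer (suc t) o p) a u
      go fwd B C left = mem⇒hashed t fwd p _ u B left
      go rev B C left = mem⇒hashed t fwd p _ u B left
      go fwd B C mid = mem⇒hashed t fwd p _ u B right
      go rev B C mid = mem⇒hashed t fwd p _ u B mid
      go fwd B C right = transport (upper-right t fwd p) (mem⇒hashed t rev _ _ u C right)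
      go rev B C right = transport (upper-right t rev p) (mem⇒hashed t rev _ _ u C right)

    left<mid : ∀ t o p → layer t o p left < layer t o p mid
    left<mid t fwd p = +-monoˡ-≤ p (fib-pos (suc t))
    left<mid t rev p = +-monoˡ-≤ p (fib-pos t)

    mid<right : ∀ t o p → layer t o p mid < layer t o p right
    mid<right t fwd p = +-monoˡ-< p (m<m+n (fib (2 + t)) (fib-pos t))
    mid<right t rev p = +-monoˡ-< p (m<n+m (fib (1 + t)) (fib-pos (suc t)))

    -- Uniqueness comes from `mem⇒hashed`: any other member has the hashes of `u` at three layers.
    -- Membership needs uniqueness in both children, hence the mutual induction.
    isolated⇒only : ∀ {L u} → Isolated h pos L u → ∀ t o p a → layer t o p right ≤ L →
      Hashed (layer t o p) a u → Only (Mem t o p a) u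
    isolated⇒mem : ∀ {L u} → Isolated h pos L u → ∀ t o p a → layer t o p right ≤ L →
      Hashed (layer t o p) a u → Mem t o p a u

    isolated⇒only iso t o p a ≤L hu = isolated⇒mem iso t o p a ≤L hu , λ v mv →
      let hv = mem⇒hashed t o p a v mv; same = λ e → trans (hv e) (sym (hu e)) in
      iso (layer t o p left) (layer t o p mid) (layer t o p right)
        (left<mid t o p) (mid<right t o p) ≤L v (same left) (same mid) (same right)

    isolated⇒mem iso zero o p a ≤L hu = hu
    isolated⇒mem {L} {u} iso (suc t) o p a ≤L hu =
      hash o , isolated⇒only iso t fwd p _ B≤L (hashB o hu) , isolated⇒only iso t rev _ _ C≤L (hashC o hu)
      where
      -- The right guess is the true hash of `u` at the layer that `a` omits.
      hash : Side → Fin r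
      hash fwd = h (layer t fwd p mid) (at (layer t fwd p mid) u)
      hash rev = h (layer t fwd p right) (at (layer t fwd p right) u)
      C≤L : layer t rev (fib (2 + t) + p) right ≤ L
      C≤L = ≤-trans (≤-reflexive (upper-right t o p)) ≤L
      B≤L : layer t fwd p right ≤ L
      B≤L = ≤-trans (≤-reflexive (sym (upper-mid t p))) (≤-trans (<⇒≤ (mid<right t rev _)) C≤L)
      hashB : ∀ o → Hashed (layer (suc t) o p) a u → Hashed (layer t fwd p) (lower o a (hash o)) u
      hashB fwd hu left = hu left
      hashB fwd hu mid = refl
      hashB fwd hu right = hu mid
      hashB rev hu left = hu left
      hashB rev hu mid = hu mid
      hashB rev hu right = refl
      hashC : ∀ o → Hashed (layer (suc t) o p) a u →
        Hashed (layer t rev (fib (2 + t) + p)) (upper o a (hash o)) u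
      hashC fwd hu left = refl
      hashC fwd hu mid = transport (sym (upper-mid t p)) (hu mid)
      hashC fwd hu right = transport (sym (upper-right t fwd p)) (hu right)
      hashC rev hu left = hu mid
      hashC rev hu mid = transport (sym (upper-mid t p)) refl
      hashC rev hu right = transport (sym (upper-right t rev p)) (hu right)

    Spec : (Fin n → Set) → ℕ → (Fin K → Fin D → Formula V) → Set
    Spec S i X = ∀ s c → Reflects (∃ λ u → S u × code (at i u) s ≡ c) (eval (X s c) ρ)

    base-reflects : ∀ o p a e → Spec (Mem 0 o p a) (layer 0 o p e) (base p a e)
    base-reflects o p a e s c = reflects-map to from
      (evalOr-tabulate λ x → evalOr-tabulate λ y → evalOr-tabulate λ z →
       ∧ᶠ-reflects {f = constᶠ (chk x y z)} {g = edge p x y ∧ᶠ edge (1 + p) y z}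
         (constᶠ-reflects (isYes-reflects (chk? x y z)))
         (∧ᶠ-reflects {f = edge p x y} {g = edge (1 + p) y z}
           (subst (λ x′ → Reflects (y ≡ at (1 + p) (x ⁻)) (eval (edge p x′ y) ρ)) (inverseʳ (pos p))
             (edge-reflects p (x ⁻) y))
           (subst (λ y′ → Reflects (z ≡ at (2 + p) (pos (1 + p) ⟨$⟩ˡ y)) (eval (edge (1 + p) y′ z) ρ))
             (inverseʳ (pos (1 + p))) (edge-reflects (1 + p) (pos (1 + p) ⟨$⟩ˡ y) z))))
      where
      chk? : ∀ x y z → Dec _
      chk? x y z = h p x F.≟ a left ×-dec h (1 + p) y F.≟ a mid ×-dec h (2 + p) z F.≟ a right
             ×-dec code (triple x y z e) s F.≟ c
      chk : Fin n → Fin n → Fin n → Bool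
      chk x y z = ⌊ chk? x y z ⌋
      _⁻ : Fin n → Fin n
      x ⁻ = pos p ⟨$⟩ˡ x
      Path : Fin n → Fin n → Fin n → Set
      Path x y z = (h p x ≡ a left × h (1 + p) y ≡ a mid × h (2 + p) z ≡ a right × code (triple x y z e) s ≡ c)
        × (y ≡ at (1 + p) (x ⁻) × z ≡ at (2 + p) (pos (1 + p) ⟨$⟩ˡ y))
      layer-mid : ∀ o → layer 0 o p mid ≡ 1 + p
      layer-mid fwd = refl
      layer-mid rev = refl
      lay : ∀ e u → triple (at p u) (at (1 + p) u) (at (2 + p) u) e ≡ at (layer 0 o p e) u
      lay left u = refl
      lay mid u = cong (λ i → at i u) (sym (layer-mid o))
      lay right u = refl
      hsh : ∀ e u → triple (h p (at p u)) (h (1 + p) (at (1 + p) u)) (h (2 + p) (at (2 + p) u)) e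
        ≡ h (layer 0 o p e) (at (layer 0 o p e) u)
      hsh left u = refl
      hsh mid u = cong (λ i → h i (at i u)) (sym (layer-mid o))
      hsh right u = refl
      along : ∀ u → Path (at p u) (at (1 + p) u) (at (2 + p) u) →
        ∃ λ u → Mem 0 o p a u × code (at (layer 0 o p e) u) s ≡ c
      along u ((hx , hy , hz , cd) , _) = u ,
        (λ { left → hx ; mid → trans (sym (hsh mid u)) hy ; right → hz }) ,
        trans (cong (λ v → code v s) (sym (lay e u))) cd
      to : (∃ λ x → ∃ λ y → ∃ λ z → Path x y z) → ∃ λ u → Mem 0 o p a u × code (at (layer 0 o p e) u) s ≡ c
      -- The edges determine `y` and `z` from `x`, so all three vertices lie on the path named
      -- `x ⁻`.
      to (x , y , z , P@(_ , refl , refl)) = along (x ⁻)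
        (subst (λ x′ → Path x′ (at (1 + p) (x ⁻)) (at (2 + p) (x ⁻))) (sym (inverseʳ (pos p)))
          (subst (λ v → Path x (at (1 + p) (x ⁻)) (at (2 + p) v)) (inverseˡ (pos (1 + p))) P))
      from : (∃ λ u → Mem 0 o p a u × code (at (layer 0 o p e) u) s ≡ c) → ∃ λ x → ∃ λ y → ∃ λ z → Path x y z
      from (u , m , cd) = at p u , at (1 + p) u , at (2 + p) u ,
        (m left , trans (hsh mid u) (m mid) , m right , trans (cong (λ v → code v s) (lay e u)) cd) ,
        cong (at (1 + p)) (sym (inverseˡ (pos p))) , cong (at (2 + p)) (sym (inverseˡ (pos (1 + p))))

    node-reflects : ∀ t o p a e → Spec (Mem t o p a) (layer t o p e) (node t o p a e)
    node-reflects zero o p a e = base-reflects o p a e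
    node-reflects (suc t) o p a e s c = reflects-map to from
      (evalOr-tabulate λ w → ∧ᶠ-reflects {f = match (B w right) (C w mid)} {g = choose (B w) (C w) (child o e) s c}
        (match-reflects s₀ code code-injective (at p₃) (at-injective p₃)
          (node-reflects t fwd p (lower o a w) right)
          (subst (λ i → Spec (MemC w) i (C w mid)) (upper-mid t p) (node-reflects t rev q (upper o a w) mid)))
        (outR o e w))
      where
      q p₃ : ℕ
      q = fib (2 + t) + p
      p₃ = layer t fwd p right
      B C : Fin r → Point → Fin K → Fin D → Formula V
      B w = node t fwd p (lower o a w)
      C w = node t rev q (upper o a w)
      MemB MemC : Fin r → Fin n → Set
      MemB w = Mem t fwd p (lower o a w)
      MemC w = Mem t rev q (upper o a w)
      MemOut : Side × Point → Fin r → Fin n → Set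
      MemOut (fwd , _) = MemB
      MemOut (rev , _) = MemC
      outR : ∀ o′ e w → Reflects (∃ λ u → MemOut (child o′ e) w u × code (at (layer (suc t) o′ p e) u) s ≡ c)
        (eval (choose (B w) (C w) (child o′ e) s c) ρ)
      outR o′ left w = node-reflects t fwd p _ left s c
      outR fwd mid w = node-reflects t fwd p _ right s c
      outR rev mid w = node-reflects t fwd p _ mid s c
      outR o′ right w = subst (λ i → Spec (MemC w) i (C w right)) (upper-right t o′ p)
        (node-reflects t rev q _ right) s c
      Match : Fin r → Set
      Match w = ∃ λ u → Only (MemB w) u × Only (MemC w) u
      to : (∃ λ w → Match w × (∃ λ u → MemOut (child o e) w u × code (at (layer (suc t) o p e) u) s ≡ c)) →
        ∃ λ u → Mem (suc t) o p a u × code (at (layer (suc t) o p e) u) s ≡ c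
      -- The digit is reported by some member `v` of a child; the certificate forces `v` to be the
      -- matched path.
      to (w , (u , oB , oC) , (v , mv , cd)) = u , (w , oB , oC) ,
        trans (cong (λ x → code (at (layer (suc t) o p e) x) s) (sym (v≡u (child o e) mv))) cd
        where
        v≡u : ∀ x → MemOut x w v → v ≡ u
        v≡u (fwd , _) m = proj₂ oB v m
        v≡u (rev , _) m = proj₂ oC v m
      from : (∃ λ u → Mem (suc t) o p a u × code (at (layer (suc t) o p e) u) s ≡ c) →
        ∃ λ w → Match w × (∃ λ u → MemOut (child o e) w u × code (at (layer (suc t) o p e) u) s ≡ c)
      from (u , (w , oB , oC) , cd) = w , (u , oB , oC) , u , mem (child o e) , cd
        where
        mem : ∀ x → MemOut x w u
        mem (fwd , _) = proj₁ oB
        mem (rev , _) = proj₁ oC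

    at-reflects : ∀ i v s c → Reflects (∃ λ u → at i u ≡ v × code (at i u) s ≡ c) (eval (constᶠ {V} ⌊ code v s F.≟ c ⌋) ρ)
    at-reflects i v s c = constᶠ-reflects (reflects-map
      (λ e → pos i ⟨$⟩ˡ v , inverseʳ (pos i) , trans (cong (λ x → code x s) (inverseʳ (pos i))) e)
      (λ { (u , refl , e) → e })
      (isYes-reflects (code v s F.≟ c)))

    -- Accepting is sound without isolation, since the two certificates name the same path.
    -- Isolation enters only in `from`, where the guess is the true hash of `u` at the middle layer.
    root-reflects : ∀ t u b → Isolated h pos (fib (3 + t) + 0) u →
      Reflects (at (fib (3 + t) + 0) u ≡ b) (eval (root t (at 0 u) b) ρ)
    root-reflects t u b iso = reflects-map to from
      (evalOr-tabulate λ y → ∧ᶠ-reflects {f = match (M y left) _} {g = match (M y right) _}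
        (match-reflects s₀ code code-injective (at 0) (at-injective 0)
          (node-reflects t fwd 0 (ends y) left) (at-reflects 0 (at 0 u)))
        (match-reflects s₀ code code-injective (at L) (at-injective L)
          (node-reflects t fwd 0 (ends y) right) (at-reflects L b)))
      where
      L = fib (3 + t) + 0
      ends : Fin r → Point → Fin r
      ends y = triple (h 0 (at 0 u)) y (h L b)
      M : Fin r → Point → Fin K → Fin D → Formula V
      M y = node t fwd 0 (ends y)
      Found : Fin r → Set
      Found y = (∃ λ v → Only (Mem t fwd 0 (ends y)) v × Only (λ v → at 0 v ≡ at 0 u) v)
              × (∃ λ v → Only (Mem t fwd 0 (ends y)) v × Only (λ v → at L v ≡ b) v)
      to : (∃ λ y → Found y) → at L u ≡ b
      to (y , (v , onlyM , onlyU) , (v′ , onlyM′ , (e , _))) =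
        trans (cong (at L) (trans (proj₂ onlyU u refl) (proj₂ onlyM′ v (proj₁ onlyM)))) e
      from : at L u ≡ b → ∃ λ y → Found y
      from e = h m (at m u) , (u , onlyM , refl , λ v → at-injective 0 v u)
                            , (u , onlyM , e , λ v e′ → at-injective L v u (trans e′ (sym e)))
        where
        m = layer t fwd 0 mid
        onlyM : Only (Mem t fwd 0 (ends (h m (at m u)))) u
        onlyM = isolated⇒only iso t fwd 0 _ ≤-refl
          λ { left → refl ; mid → refl ; right → cong (h L) e }

-- Size and depth bounds

matchBound : ℕ → ℕ → ℕ → ℕ
matchBound K D z = suc (K * suc (D * suc (D * suc (suc z + suc z))))

-- The innermost 5 counts two conjunctions, one hardwired constant and at most one gate for each of
-- two edges.
nodeBound : (n r K D t : ℕ) → ℕ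
nodeBound n r K D zero = suc (n * suc (n * suc (n * 5)))
nodeBound n r K D (suc t) = suc (r * suc (matchBound K D (nodeBound n r K D t) + nodeBound n r K D t))

-- Absorbing each additional gate into the coefficient keeps every bound a monomial. The 8 of
-- `matchBound≤` is 4 for the two literals plus 4 such absorptions.
suc-scale : ∀ {x y} c → 1 ≤ x → y ≤ c * x → suc y ≤ suc c * x
suc-scale c = +-mono-≤

*-scale : ∀ {x y} m c → y ≤ c * x → m * y ≤ c * (m * x)
*-scale {x} {y} m c p = ≤-trans (*-monoʳ-≤ m p) (≤-reflexive
  (trans (sym (*-assoc m c x)) (trans (cong (_* x) (*-comm m c)) (*-assoc c m x))))

m≤k*m : ∀ {k m} → 1 ≤ k → m ≤ k * m
m≤k*m {k} {m} p = ≤-trans (≤-reflexive (sym (*-identityˡ m))) (*-monoˡ-≤ m p)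

1≤* : ∀ {m n} → 1 ≤ m → 1 ≤ n → 1 ≤ m * n
1≤* = *-mono-≤

matchBound≤ : ∀ {K D z} → 1 ≤ K → 1 ≤ D → 1 ≤ z → matchBound K D z ≤ 8 * (K * (D * (D * z)))
matchBound≤ {K} {D} {z} pK pD pz =
  suc-scale 7 (1≤* pK (1≤* pD (1≤* pD pz))) (*-scale K 7
  (suc-scale 6 (1≤* pD (1≤* pD pz)) (*-scale D 6
  (suc-scale 5 (1≤* pD pz) (*-scale D 5
  (suc-scale 4 pz (≤-trans (+-mono-≤ 2z 2z) (≤-reflexive (sym (*-distribʳ-+ z 2 2))))))))))
  where
  2z : suc z ≤ 2 * z
  2z = suc-scale 1 pz (≤-reflexive (sym (*-identityˡ z)))

-- The cost of a join up to constants: r guesses, K positions, and D² pairs of a candidate digit and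
-- a tested digit.
growth : (r K D : ℕ) → ℕ
growth r K D = r * (K * (D * D))

1≤suc : ∀ {n} → 1 ≤ suc n
1≤suc = s≤s z≤n

nodeBound≥1 : ∀ n r K D t → 1 ≤ nodeBound n r K D t
nodeBound≥1 n r K D zero = 1≤suc
nodeBound≥1 n r K D (suc t) = 1≤suc

-- 18 = 8 + 8 + 1 + 1. Here `y` is the child that is read off in a node, and the second match in the
-- root.
layerBound : ∀ {r K D z y} → 1 ≤ r → 1 ≤ K → 1 ≤ D → 1 ≤ z → y ≤ 8 * (K * (D * (D * z))) →
  suc (r * suc (matchBound K D z + y)) ≤ 18 * growth r K D * z
layerBound {r} {K} {D} {z} {y} pr pK pD pz py = ≤-trans
  (suc-scale 17 (1≤* pr x≥1) (*-scale r 17 (suc-scale 16 x≥1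
    (≤-trans (+-mono-≤ (matchBound≤ pK pD pz) py) (≤-reflexive (sym (*-distribʳ-+ x 8 8)))))))
  (≤-reflexive (solve 4 (λ r K D z → con 18 :* (r :* (K :* (D :* (D :* z)))) :=
     con 18 :* (r :* (K :* (D :* D))) :* z) refl r K D z))
  where
  open +-*-Solver
  x = K * (D * (D * z))
  x≥1 : 1 ≤ x
  x≥1 = 1≤* pK (1≤* pD (1≤* pD pz))

nodeBound≤ : ∀ {n r K D} → 1 ≤ n → 1 ≤ r → 1 ≤ K → 1 ≤ D → ∀ t →
  nodeBound n r K D t ≤ (18 * growth r K D) ^ t * (8 * n ^ 3)
nodeBound≤ {n} pn pr pK pD zero = ≤-trans
  (suc-scale 7 (1≤* pn (1≤* pn pn)) (*-scale n 7 (suc-scale 6 (1≤* pn pn) (*-scale n 6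
    (suc-scale 5 pn (≤-reflexive (*-comm n 5)))))))
  (≤-reflexive (solve 1 (λ n → con 8 :* (n :* (n :* n)) := con 1 :* (con 8 :* (n :^ 3))) refl n))
  where open +-*-Solver
nodeBound≤ {n} {r} {K} {D} pn pr pK pD (suc t) = ≤-trans
  (layerBound pr pK pD (nodeBound≥1 n r K D t)
    (≤-trans (m≤k*m pD) (≤-trans (m≤k*m pD) (≤-trans (m≤k*m pK) (m≤k*m {8} 1≤suc)))))
  (≤-trans (*-monoʳ-≤ G (nodeBound≤ pn pr pK pD t)) (≤-reflexive (sym (*-assoc G (G ^ t) _))))
  where
  G = 18 * growth r K D
  z = nodeBound n r K D t

rootBound≤ : ∀ {n r K D} → 1 ≤ n → 1 ≤ r → 1 ≤ K → 1 ≤ D → ∀ t →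
  let m = matchBound K D (nodeBound n r K D t) in
  suc (r * suc (m + m)) ≤ (18 * growth r K D) ^ suc t * (8 * n ^ 3)
rootBound≤ {n} {r} {K} {D} pn pr pK pD t = ≤-trans
  (layerBound pr pK pD (nodeBound≥1 n r K D t) (matchBound≤ pK pD (nodeBound≥1 n r K D t)))
  (≤-trans (*-monoʳ-≤ G (nodeBound≤ pn pr pK pD t)) (≤-reflexive (sym (*-assoc G (G ^ t) _))))
  where
  G = 18 * growth r K D

module _ {V : Set} {n r K D : ℕ} (code : Fin n → Fin K → Fin D)
         (edge : ℕ → Fin n → Fin n → Formula V) (h : ℕ → Fin n → Fin r) where
  open Construction code edge h

  module _ (edge-size : ∀ i u v → size (edge i u v) ≤ 1) where
    node-size : ∀ t o p a e s c → size (node t o p a e s c) ≤ nodeBound n r K D t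
    choose-size : ∀ t o p a w x s c →
      size (choose (node t fwd p (lower o a w)) (node t rev (fib (2 + t) + p) (upper o a w)) x s c)
        ≤ nodeBound n r K D t

    node-size zero o p a e s c =
      ⋁-size {f = λ x → ⋁ λ y → ⋁ λ z → _} λ x → ⋁-size {f = λ y → ⋁ λ z → _} λ y → ⋁-size {f = λ z → _} λ z →
      ∧ᶠ-size (constᶠ _) (edge p x y ∧ᶠ edge (1 + p) y z) (≤-reflexive (constᶠ-size _))
        (∧ᶠ-size (edge p x y) (edge (1 + p) y z) (edge-size p x y) (edge-size (1 + p) y z))
    node-size (suc t) o p a e s c = ⋁-size {f = λ w → _} λ w →
      ∧ᶠ-size (match (B w right) (C w mid)) (choose (B w) (C w) (child o e) s c)
        (match-size (B w right) (C w mid) (node-size t fwd p (lower o a w) right) (node-size t rev _ (upper o a w) mid))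
        (choose-size t o p a w (child o e) s c)
      where
      B C : Fin r → Point → Fin K → Fin D → Formula V
      B w = node t fwd p (lower o a w)
      C w = node t rev (fib (2 + t) + p) (upper o a w)

    choose-size t o p a w (fwd , e) s c = node-size t fwd p _ e s c
    choose-size t o p a w (rev , e) s c = node-size t rev _ _ e s c

    root-size : ∀ t a b → 1 ≤ n → 1 ≤ r → 1 ≤ K → 1 ≤ D →
      size (root t a b) ≤ (18 * growth r K D) ^ suc t * (8 * n ^ 3)
    root-size t a b pn pr pK pD = ≤-trans
      (⋁-size {f = λ y → _} λ y → ∧ᶠ-size (match (M y left) (X a)) (match (M y right) (X b))
        (match-size (M y left) (X a) (node-size t fwd 0 _ left) (X-size a))
        (match-size (M y right) (X b) (node-size t fwd 0 _ right) (X-size b)))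
      (rootBound≤ pn pr pK pD t)
      where
      M : Fin r → Point → Fin K → Fin D → Formula V
      M y = node t fwd 0 (triple (h 0 a) y (h (fib (3 + t) + 0) b))
      X : Fin n → Fin K → Fin D → Formula V
      X a s c = constᶠ ⌊ code a s F.≟ c ⌋
      X-size : ∀ a s c → size (X a s c) ≤ nodeBound n r K D t
      X-size a s c = ≤-trans (≤-reflexive (constᶠ-size _)) (nodeBound≥1 n r K D t)

  module _ (edge-depth : ∀ i u v → depth (edge i u v) ≤ 1) where
    -- A level adds 7: the OR over guesses, a conjunction, and 5 for `match`. The 6 of the base is
    -- three ORs, two conjunctions and a leaf of depth at most 1.
    node-depth : ∀ t o p a e s c → depth (node t o p a e s c) ≤ t * 7 + 6
    choose-depth : ∀ t o p a w x s c →
      depth (choose (node t fwd p (lower o a w)) (node t rev (fib (2 + t) + p) (upper o a w)) x s c)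
        ≤ t * 7 + 6

    node-depth zero o p a e s c =
      ⋁-depth {f = λ x → ⋁ λ y → ⋁ λ z → _} λ x → ⋁-depth {f = λ y → ⋁ λ z → _} λ y → ⋁-depth {f = λ z → _} λ z →
      ∧ᶠ-depth (constᶠ _) (edge p x y ∧ᶠ edge (1 + p) y z) (≤-trans (≤-reflexive (constᶠ-depth _)) 1≤suc)
        (∧ᶠ-depth (edge p x y) (edge (1 + p) y z) (edge-depth p x y) (edge-depth (1 + p) y z))
    node-depth (suc t) o p a e s c = ⋁-depth {f = λ w → _} λ w →
      ∧ᶠ-depth (match (B w right) (C w mid)) (choose (B w) (C w) (child o e) s c)
        (match-depth (B w right) (C w mid) (node-depth t fwd p (lower o a w) right) (node-depth t rev _ (upper o a w) mid))
        (≤-trans (choose-depth t o p a w (child o e) s c) (m≤n+m _ 5))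
      where
      B C : Fin r → Point → Fin K → Fin D → Formula V
      B w = node t fwd p (lower o a w)
      C w = node t rev (fib (2 + t) + p) (upper o a w)

    choose-depth t o p a w (fwd , e) s c = node-depth t fwd p _ e s c
    choose-depth t o p a w (rev , e) s c = node-depth t rev _ _ e s c

    root-depth : ∀ t a b → depth (root t a b) ≤ suc t * 7 + 6
    root-depth t a b =
      ⋁-depth {f = λ y → _} λ y → ∧ᶠ-depth (match (M y left) (X a)) (match (M y right) (X b))
        (match-depth (M y left) (X a) (node-depth t fwd 0 _ left) (X-depth a))
        (match-depth (M y right) (X b) (node-depth t fwd 0 _ right) (X-depth b))
      where
      M : Fin r → Point → Fin K → Fin D → Formula V
      M y = node t fwd 0 (triple (h 0 a) y (h (fib (3 + t) + 0) b))
      X : Fin n → Fin K → Fin D → Formula V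
      X a s c = constᶠ ⌊ code a s F.≟ c ⌋
      X-depth : ∀ a s c → depth (X a s c) ≤ t * 7 + 6
      X-depth a s c = ≤-trans (≤-reflexive (constᶠ-depth _)) (≤-trans 1≤suc (m≤n+m 6 (t * 7)))

-- Padding by identities and the matrix product

compose : ∀ {n} → (ℕ → Permutation′ n) → ℕ → Permutation′ n
compose σ zero = idₚ
compose σ (suc i) = compose σ i ∘ₚ σ i

pad : ∀ {n} k → (Fin k → Permutation′ n) → ℕ → Permutation′ n
pad zero π i = idₚ
pad (suc k) π zero = π zero
pad (suc k) π (suc i) = pad k (π ∘ suc) i

padEdge : ∀ {n} k → (Fin k → Fin n → Fin n → V) → ℕ → Fin n → Fin n → Formula V
padEdge zero ι i u v = constᶠ ⌊ u F.≟ v ⌋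
padEdge (suc k) ι zero u v = var (ι zero u v)
padEdge (suc k) ι (suc i) = padEdge k (ι ∘ suc) i

padEdge-size : ∀ {n} k (ι : Fin k → Fin n → Fin n → V) i u v → size (padEdge k ι i u v) ≤ 1
padEdge-size zero ι i u v = ≤-reflexive (constᶠ-size _)
padEdge-size (suc k) ι zero u v = z≤n
padEdge-size (suc k) ι (suc i) = padEdge-size k (ι ∘ suc) i

padEdge-depth : ∀ {n} k (ι : Fin k → Fin n → Fin n → V) i u v → depth (padEdge k ι i u v) ≤ 1
padEdge-depth zero ι i u v = ≤-reflexive (constᶠ-depth _)
padEdge-depth (suc k) ι zero u v = z≤n
padEdge-depth (suc k) ι (suc i) = padEdge-depth k (ι ∘ suc) i

padEdge-reflects : ∀ {n} k (ι : Fin k → Fin n → Fin n → V) (π : Fin k → Permutation′ n) {ρ} →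
  (∀ t u v → ρ (ι t u v) ≡ ⌊ (π t ⟨$⟩ʳ u) F.≟ v ⌋) →
  ∀ i u v → Reflects (v ≡ pad k π i ⟨$⟩ʳ u) (eval (padEdge k ι i u v) ρ)
padEdge-reflects zero ι π e i u v = constᶠ-reflects (reflects-map sym sym (isYes-reflects (u F.≟ v)))
padEdge-reflects (suc k) ι π e zero u v = subst (Reflects _) (sym (e zero u v))
  (reflects-map sym sym (isYes-reflects ((π zero ⟨$⟩ʳ u) F.≟ v)))
padEdge-reflects (suc k) ι π e (suc i) = padEdge-reflects k (ι ∘ suc) (π ∘ suc) (e ∘ suc) i

-- `prodMats` splits off its first factor while `compose` appends at the end; this moves the first
-- factor across.
compose-shift : ∀ {n} (σ : ℕ → Permutation′ n) i u →
  compose σ (suc i) ⟨$⟩ʳ u ≡ compose (σ ∘ suc) i ⟨$⟩ʳ (σ 0 ⟨$⟩ʳ u)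
compose-shift σ zero u = refl
compose-shift σ (suc i) u = cong (σ (suc i) ⟨$⟩ʳ_) (compose-shift σ i u)

compose-id : ∀ {n} i (u : Fin n) → compose (λ _ → idₚ) i ⟨$⟩ʳ u ≡ u
compose-id zero u = refl
compose-id (suc i) u = compose-id i u

sumFin-cong : ∀ n {f g : Fin n → ℕ} → (∀ i → f i ≡ g i) → sumFin n f ≡ sumFin n g
sumFin-cong zero e = refl
sumFin-cong (suc n) e = cong₂ _+_ (e zero) (sumFin-cong n (e ∘ suc))

sumFin-zero : ∀ n → sumFin n (λ _ → 0) ≡ 0
sumFin-zero zero = refl
sumFin-zero (suc n) = sumFin-zero n

suc-≟ : ∀ {n} (c l : Fin n) → ⌊ Fin.suc c F.≟ suc l ⌋ ≡ ⌊ c F.≟ l ⌋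
suc-≟ c l = det (isYes-reflects (suc c F.≟ suc l)) (reflects-map (cong suc) (λ { refl → refl }) (isYes-reflects (c F.≟ l)))

sumFin-delta : ∀ n (c : Fin n) (f : Fin n → ℕ) → sumFin n (λ l → b2n ⌊ c F.≟ l ⌋ * f l) ≡ f c
sumFin-delta (suc n) zero f = trans (cong (f zero + 0 +_) (sumFin-zero n)) (trans (+-identityʳ _) (+-identityʳ _))
sumFin-delta (suc n) (suc c) f = trans (sumFin-cong n (λ l → cong (λ b → b2n b * f (suc l)) (suc-≟ c l)))
  (sumFin-delta n c (f ∘ suc))

prodMats-perm : ∀ {n} k (Q : Fin k → BMat n) (π : Fin k → Permutation′ n) →
  (∀ t i j → Q t i j ≡ ⌊ (π t ⟨$⟩ʳ i) F.≟ j ⌋) → ∀ L → k ≤ L → ∀ a b →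
  prodMats k Q a b ≡ b2n ⌊ (compose (pad k π) L ⟨$⟩ʳ a) F.≟ b ⌋
prodMats-perm zero Q π e L _ a b = cong (λ x → b2n ⌊ x F.≟ b ⌋) (sym (compose-id L a))
prodMats-perm {n} (suc k) Q π e (suc L) (s≤s k≤L) a b = begin
  sumFin n (λ l → b2n (Q zero a l) * prodMats k (Q ∘ suc) l b)
    ≡⟨ sumFin-cong n (λ l → cong (λ x → b2n x * prodMats k (Q ∘ suc) l b) (e zero a l)) ⟩
  sumFin n (λ l → b2n ⌊ (π zero ⟨$⟩ʳ a) F.≟ l ⌋ * prodMats k (Q ∘ suc) l b)
    ≡⟨ sumFin-delta n (π zero ⟨$⟩ʳ a) _ ⟩
  prodMats k (Q ∘ suc) (π zero ⟨$⟩ʳ a) b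
    ≡⟨ prodMats-perm k (Q ∘ suc) (π ∘ suc) (e ∘ suc) L k≤L _ b ⟩
  b2n ⌊ (compose (pad k (π ∘ suc)) L ⟨$⟩ʳ (π zero ⟨$⟩ʳ a)) F.≟ b ⌋
    ≡⟨ cong (λ x → b2n ⌊ x F.≟ b ⌋) (compose-shift (pad (suc k) π) L a) ⟨
  b2n ⌊ (compose (pad (suc k) π) (suc L) ⟨$⟩ʳ a) F.≟ b ⌋ ∎
  where open ≡-Reasoning

b2n-≡ᵇ1 : ∀ b → (b2n b ℕ.≡ᵇ 1) ≡ b
b2n-≡ᵇ1 true = refl
b2n-≡ᵇ1 false = refl

-- Random sequences

∑ : List A → (A → ℕ) → ℕ
∑ [] f = 0
∑ (x ∷ xs) f = f x + ∑ xs f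

∑-mono : ∀ (xs : List A) {f g} → (∀ x → f x ≤ g x) → ∑ xs f ≤ ∑ xs g
∑-mono [] p = z≤n
∑-mono (x ∷ xs) p = +-mono-≤ (p x) (∑-mono xs p)

∑-const : ∀ (xs : List A) c → ∑ xs (λ _ → c) ≡ length xs * c
∑-const [] c = refl
∑-const (x ∷ xs) c = cong (c +_) (∑-const xs c)

∑-*ʳ : ∀ (xs : List A) f c → ∑ xs (λ x → f x * c) ≡ ∑ xs f * c
∑-*ʳ [] f c = refl
∑-*ʳ (x ∷ xs) f c = trans (cong (f x * c +_) (∑-*ʳ xs f c)) (sym (*-distribʳ-+ c (f x) (∑ xs f)))

∑-*ˡ : ∀ (xs : List A) c f → ∑ xs (λ x → c * f x) ≡ c * ∑ xs f
∑-*ˡ [] c f = sym (*-zeroʳ c)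
∑-*ˡ (x ∷ xs) c f = trans (cong (c * f x +_) (∑-*ˡ xs c f)) (sym (*-distribˡ-+ c (f x) (∑ xs f)))

interchange : ∀ a b c d → (a + b) + (c + d) ≡ (a + c) + (b + d)
interchange = solve 4 (λ a b c d → (a :+ b) :+ (c :+ d) := (a :+ c) :+ (b :+ d)) refl
  where open +-*-Solver

∑-+ : ∀ (xs : List A) f g → ∑ xs (λ x → f x + g x) ≡ ∑ xs f + ∑ xs g
∑-+ [] f g = refl
∑-+ (x ∷ xs) f g = trans (cong (f x + g x +_) (∑-+ xs f g)) (interchange (f x) (g x) _ _)

∑-swap : ∀ (xs : List A) (ys : List A′) (f : A → A′ → ℕ) → ∑ xs (λ x → ∑ ys (f x)) ≡ ∑ ys (λ y → ∑ xs (λ x → f x y))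
∑-swap [] ys f = sym (trans (∑-const ys 0) (*-zeroʳ (length ys)))
∑-swap (x ∷ xs) ys f = trans (cong (∑ ys (f x) +_) (∑-swap xs ys f)) (sym (∑-+ ys (f x) _))

∑-++ : ∀ (xs ys : List A) f → ∑ (xs ++ ys) f ≡ ∑ xs f + ∑ ys f
∑-++ [] ys f = refl
∑-++ (x ∷ xs) ys f = trans (cong (f x +_) (∑-++ xs ys f)) (sym (+-assoc (f x) _ _))

∑-map : ∀ (g : A′ → A) xs f → ∑ (map g xs) f ≡ ∑ xs (f ∘ g)
∑-map g [] f = refl
∑-map g (x ∷ xs) f = cong (f (g x) +_) (∑-map g xs f)

∑-tabulate : ∀ n (g : Fin n → A) f → ∑ (tabulate g) f ≡ sumFin n (f ∘ g)
∑-tabulate zero g f = refl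
∑-tabulate (suc n) g f = cong (f (g zero) +_) (∑-tabulate n (g ∘ suc) f)

∑-cartesianProductWith : ∀ {C : Set} (p : A → A′ → C) xs ys f →
  ∑ (cartesianProductWith p xs ys) f ≡ ∑ xs (λ x → ∑ ys (λ y → f (p x y)))
∑-cartesianProductWith p [] ys f = refl
∑-cartesianProductWith p (x ∷ xs) ys f = trans (∑-++ (map (p x) ys) _ f)
  (cong₂ _+_ (∑-map (p x) ys f) (∑-cartesianProductWith p xs ys f))

push : A → (ℕ → A) → ℕ → A
push x f zero = x
push x f (suc i) = f i

-- The first m values of a sequence range over all of xs; the later ones are the junk value d.
sequences : A → List A → ℕ → List (ℕ → A)
sequences d xs zero = (λ _ → d) ∷ []
sequences d xs (suc m) = cartesianProductWith push xs (sequences d xs m)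

length-∑ : ∀ (xs : List A) → length xs ≡ ∑ xs (λ _ → 1)
length-∑ xs = sym (trans (∑-const xs 1) (*-identityʳ _))

length-sequences : ∀ (d : A) xs m → length (sequences d xs m) ≡ length xs ^ m
length-sequences d xs zero = refl
length-sequences d xs (suc m) = begin
  length (sequences d xs (suc m)) ≡⟨ length-∑ (sequences d xs (suc m)) ⟩
  ∑ (sequences d xs (suc m)) (λ _ → 1) ≡⟨ ∑-cartesianProductWith push xs _ _ ⟩
  ∑ xs (λ _ → ∑ (sequences d xs m) (λ _ → 1)) ≡⟨ ∑-const xs _ ⟩
  length xs * ∑ (sequences d xs m) (λ _ → 1) ≡⟨ cong (length xs *_) (length-∑ (sequences d xs m)) ⟨
  length xs * length (sequences d xs m) ≡⟨ cong (length xs *_) (length-sequences d xs m) ⟩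
  length xs ^ suc m ∎
  where open ≡-Reasoning

module _ {A : Set} (d : A) (xs : List A) where

  -- An expectation of at most 1, cleared of denominators. Indicators will be scaled by `r`, so that
  -- a collision of probability 1 / r has mean 1.
  Average≤1 : ℕ → ((ℕ → A) → ℕ) → Set
  Average≤1 m G = ∑ (sequences d xs m) G ≤ length xs ^ m

  average-const : ∀ m → Average≤1 m (λ _ → 1)
  average-const m = ≤-reflexive (trans (sym (length-∑ (sequences d xs m))) (length-sequences d xs m))

  -- Entry 0 is independent of the later ones, so the sum of the product factors.
  average-push : ∀ m G {α : A → ℕ} → ∑ xs α ≤ length xs → Average≤1 m G →
    Average≤1 (suc m) (λ f → α (f 0) * G (f ∘ suc))
  average-push m G {α} pα pG = begin
    ∑ (sequences d xs (suc m)) (λ f → α (f 0) * G (f ∘ suc)) ≡⟨ ∑-cartesianProductWith push xs _ _ ⟩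
    ∑ xs (λ x → ∑ (sequences d xs m) (λ f → α x * G f)) ≤⟨ ∑-mono xs (λ x → ≤-trans
      (≤-reflexive (∑-*ˡ (sequences d xs m) (α x) G)) (*-monoʳ-≤ (α x) pG)) ⟩
    ∑ xs (λ x → α x * length xs ^ m) ≡⟨ ∑-*ʳ xs α _ ⟩
    ∑ xs α * length xs ^ m ≤⟨ *-monoˡ-≤ _ pα ⟩
    length xs ^ suc m ∎
    where open ≤-Reasoning

  average-skip : ∀ m G → Average≤1 m G → Average≤1 (suc m) (λ f → G (f ∘ suc))
  average-skip m G pG = begin
    ∑ (sequences d xs (suc m)) (λ f → G (f ∘ suc)) ≡⟨ ∑-cartesianProductWith push xs _ _ ⟩
    ∑ xs (λ x → ∑ (sequences d xs m) G) ≡⟨ ∑-const xs _ ⟩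
    length xs * ∑ (sequences d xs m) G ≤⟨ *-monoʳ-≤ (length xs) pG ⟩
    length xs ^ suc m ∎
    where open ≤-Reasoning

  module _ {α β γ : A → ℕ} (pα : ∑ xs α ≤ length xs) (pβ : ∑ xs β ≤ length xs) (pγ : ∑ xs γ ≤ length xs) where
    -- The trailing `* 1` is the constant with which the product of factors ends, so that
    -- `average-push` applies unchanged.
    average₁ : ∀ {l m} → l < m → Average≤1 m (λ f → γ (f l) * 1)
    average₁ {zero} {suc m} _ = average-push m (λ _ → 1) pγ (average-const m)
    average₁ {suc l} {suc m} (s≤s l<m) = average-skip m (λ f → γ (f l) * 1) (average₁ l<m)

    average₂ : ∀ {j l m} → j < l → l < m → Average≤1 m (λ f → β (f j) * (γ (f l) * 1))
    average₂ {zero} {suc l} {suc m} _ (s≤s l<m) = average-push m (λ f → γ (f l) * 1) pβ (average₁ l<m)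
    average₂ {suc j} {suc l} {suc m} (s≤s j<l) (s≤s l<m) = average-skip m (λ f → β (f j) * (γ (f l) * 1)) (average₂ j<l l<m)

    average₃ : ∀ {i j l m} → i < j → j < l → l < m →
      Average≤1 m (λ f → α (f i) * (β (f j) * (γ (f l) * 1)))
    average₃ {zero} {suc j} {suc l} {suc m} _ (s≤s j<l) (s≤s l<m) = average-push m (λ f → β (f j) * (γ (f l) * 1)) pα (average₂ j<l l<m)
    average₃ {suc i} {suc j} {suc l} {suc m} (s≤s i<j) (s≤s j<l) (s≤s l<m) =
      average-skip m (λ f → α (f i) * (β (f j) * (γ (f l) * 1))) (average₃ i<j j<l l<m)

-- Hash collisions and the union bound

⟦_⟧ : {P : Set} → Dec P → ℕ
⟦ P? ⟧ = b2n ⌊ P? ⌋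

⟦⟧-mono : ∀ {P Q : Set} (P? : Dec P) (Q? : Dec Q) → (P → Q) → ⟦ P? ⟧ ≤ ⟦ Q? ⟧
⟦⟧-mono (yes p) (yes q) i = ≤-refl
⟦⟧-mono (yes p) (no ¬q) i = ⊥-elim (¬q (i p))
⟦⟧-mono (no ¬p) Q? i = z≤n

⟦⟧-true : ∀ {P : Set} (P? : Dec P) → P → ⟦ P? ⟧ ≡ 1
⟦⟧-true (yes p) _ = refl
⟦⟧-true (no ¬p) p = ⊥-elim (¬p p)

-- With all other entries fixed, exactly one of the r values of the earlier entry equals the later
-- one; exchanging the sums exposes this.
collision : ∀ {r} (d : Fin r) {u v m} → u < v → v < m →
  ∑ (sequences d (allFin r) m) (λ f → r * ⟦ f v F.≟ f u ⟧) ≤ length (sequences d (allFin r) m)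
collision {r} d {zero} {suc v} {suc m} _ (s≤s v<m) = ≤-reflexive (begin
  ∑ (sequences d (allFin r) (suc m)) (λ f → r * ⟦ f (suc v) F.≟ f 0 ⟧)
    ≡⟨ ∑-cartesianProductWith push (allFin r) S _ ⟩
  ∑ (allFin r) (λ x → ∑ S (λ f → r * ⟦ f v F.≟ x ⟧))
    ≡⟨ ∑-swap (allFin r) S _ ⟩
  ∑ S (λ f → ∑ (allFin r) (λ x → r * ⟦ f v F.≟ x ⟧))
    ≡⟨ ∑-cong S (λ f → begin
         ∑ (allFin r) (λ x → r * ⟦ f v F.≟ x ⟧) ≡⟨ ∑-tabulate r (λ x → x) _ ⟩
         sumFin r (λ x → r * ⟦ f v F.≟ x ⟧) ≡⟨ sumFin-cong r (λ x → *-comm r _) ⟩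
         sumFin r (λ x → ⟦ f v F.≟ x ⟧ * r) ≡⟨ sumFin-delta r (f v) (λ _ → r) ⟩
         r ∎) ⟩
  ∑ S (λ _ → r) ≡⟨ ∑-const S r ⟩
  length S * r ≡⟨ *-comm (length S) r ⟩
  r * length S ≡⟨ cong₂ _*_ (sym (length-tabulate {n = r} (λ x → x))) (length-sequences d (allFin r) m) ⟩
  length (allFin r) ^ suc m ≡⟨ length-sequences d (allFin r) (suc m) ⟨
  length (sequences d (allFin r) (suc m)) ∎)
  where
  open ≡-Reasoning
  S = sequences d (allFin r) m
  ∑-cong : ∀ {A : Set} (xs : List A) {f g} → (∀ x → f x ≡ g x) → ∑ xs f ≡ ∑ xs g
  ∑-cong [] e = refl
  ∑-cong (x ∷ xs) e = cong₂ _+_ (e x) (∑-cong xs e)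
collision {r} d {suc u} {suc v} {suc m} (s≤s u<v) (s≤s v<m) =
  ≤-trans (average-skip d (allFin r) m (λ f → r * ⟦ f v F.≟ f u ⟧)
    (≤-trans (collision d u<v v<m) (≤-reflexive (length-sequences d (allFin r) m))))
  (≤-reflexive (sym (length-sequences d (allFin r) (suc m))))

sumFin≥term : ∀ {m} (g : Fin m → ℕ) i → g i ≤ sumFin m g
sumFin≥term g zero = m≤m+n _ _
sumFin≥term g (suc i) = ≤-trans (sumFin≥term (g ∘ suc) i) (m≤n+m _ _)

sumFin≥term-toℕ : ∀ {m} (g : ℕ → ℕ) {i} → i < m → g i ≤ sumFin m (g ∘ toℕ)
sumFin≥term-toℕ {suc m} g {zero} _ = m≤m+n _ _
sumFin≥term-toℕ {suc m} g {suc i} (s≤s i<m) = ≤-trans (sumFin≥term-toℕ (g ∘ suc) i<m) (m≤n+m _ _)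

∑-sumFin≤ : ∀ m R b (xs : List A) {F : Fin m → A → ℕ} → (∀ i → R * ∑ xs (F i) ≤ b) →
  R * ∑ xs (λ x → sumFin m (λ i → F i x)) ≤ m * b
∑-sumFin≤ zero R b xs p = ≤-reflexive (trans (cong (R *_) (trans (∑-const xs 0) (*-zeroʳ (length xs)))) (*-zeroʳ R))
∑-sumFin≤ (suc m) R b xs {F} p = begin
  R * ∑ xs (λ x → F zero x + sumFin m (λ i → F (suc i) x)) ≡⟨ cong (R *_) (∑-+ xs _ _) ⟩
  R * (∑ xs (F zero) + ∑ xs (λ x → sumFin m (λ i → F (suc i) x))) ≡⟨ *-distribˡ-+ R _ _ ⟩
  R * ∑ xs (F zero) + R * ∑ xs (λ x → sumFin m (λ i → F (suc i) x))
    ≤⟨ +-mono-≤ (p zero) (∑-sumFin≤ m R b xs (p ∘ suc)) ⟩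
  suc m * b ∎
  where open ≤-Reasoning

-- One independent table per layer: this independence makes three collisions as rare as 1 / r³.
seeds : ∀ {r} → Fin r → ℕ → ℕ → List (ℕ → ℕ → Fin r)
seeds {r} d n m = sequences (λ _ → d) (sequences d (allFin r) n) m

hash : ∀ {r n} → (ℕ → ℕ → Fin r) → ℕ → Fin n → Fin r
hash σ i u = σ i (toℕ u)

module _ {r : ℕ} (d : Fin r) {n : ℕ} where

  private
    X = sequences d (allFin r) n

  Collide : (x y : Fin n) → (ℕ → Fin r) → Set
  Collide x y f = f (toℕ x) ≡ f (toℕ y)

  collide? : ∀ x y f → Dec (Collide x y f)
  collide? x y f = f (toℕ x) F.≟ f (toℕ y)

  collision-≢ : ∀ x y → x ≢ y → ∑ X (λ f → r * ⟦ collide? x y f ⟧) ≤ length X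
  collision-≢ x y x≢y with <-cmp (toℕ x) (toℕ y)
  ... | tri< x<y _ _ = ≤-trans
    (∑-mono X λ f → *-monoʳ-≤ r (⟦⟧-mono (collide? x y f) (collide? y x f) sym))
    (collision d x<y (toℕ<n y))
  ... | tri≈ _ x≡y _ = ⊥-elim (x≢y (toℕ-injective x≡y))
  ... | tri> _ _ y<x = collision d y<x (toℕ<n x)

  module _ (pos : ℕ → Permutation′ n) (L : ℕ) (u : Fin n) where

    private
      m = suc L
      H = seeds d n m

    Merge : (ℕ → ℕ → Fin r) → Fin n → ℕ → Set
    Merge σ v i = Collide (pos i ⟨$⟩ʳ v) (pos i ⟨$⟩ʳ u) (σ i)

    merge? : ∀ σ v i → Dec (Merge σ v i)
    merge? σ v i = collide? (pos i ⟨$⟩ʳ v) (pos i ⟨$⟩ʳ u) (σ i)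

    Bad : (ℕ → ℕ → Fin r) → ℕ → ℕ → ℕ → Fin n → Set
    Bad σ i j l v = (i < j × j < l × v ≢ u) × (Merge σ v i × Merge σ v j × Merge σ v l)

    valid? : ∀ i j l v → Dec (i < j × j < l × v ≢ u)
    valid? i j l v = i <? j ×-dec j <? l ×-dec ¬? (v F.≟ u)

    bad? : ∀ σ i j l v → Dec (Bad σ i j l v)
    bad? σ i j l v = valid? i j l v ×-dec merge? σ v i ×-dec merge? σ v j ×-dec merge? σ v l

    ⟦⟧-× : ∀ {P Q S : Set} (p : Dec P) (q : Dec Q) (s : Dec S) →
      r * (r * r) * ⟦ p ×-dec q ×-dec s ⟧ ≤ r * ⟦ p ⟧ * (r * ⟦ q ⟧ * (r * ⟦ s ⟧ * 1))
    ⟦⟧-× (yes p) (yes q) (yes s) = ≤-reflexive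
      (solve 1 (λ r → r :* (r :* r) :* con 1 := r :* con 1 :* (r :* con 1 :* (r :* con 1 :* con 1))) refl r)
      where open +-*-Solver
    ⟦⟧-× (yes p) (yes q) (no s) = ≤-trans (≤-reflexive (*-zeroʳ (r * (r * r)))) z≤n
    ⟦⟧-× (yes p) (no q) s = ≤-trans (≤-reflexive (*-zeroʳ (r * (r * r)))) z≤n
    ⟦⟧-× (no p) q s = ≤-trans (≤-reflexive (*-zeroʳ (r * (r * r)))) z≤n

    -- Distinct paths occupy distinct vertices at every layer, because the layers are related by
    -- permutations. Each of the three independent tables then merges them with probability at most
    -- 1 / r.
    bad-rare : ∀ i j l v → l < m → r * (r * r) * ∑ H (λ σ → ⟦ bad? σ i j l v ⟧) ≤ length H
    bad-rare i j l v l<m with valid? i j l v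
    ... | no _ = ≤-trans (≤-reflexive (trans (cong (r * (r * r) *_) (trans (∑-const H 0) (*-zeroʳ (length H))))
        (*-zeroʳ (r * (r * r))))) z≤n
    ... | yes valid@(i<j , j<l , v≢u) = begin
      r * (r * r) * ∑ H (λ σ → ⟦ yes valid ×-dec merges σ ⟧)
        ≡⟨ ∑-*ˡ H (r * (r * r)) _ ⟨
      ∑ H (λ σ → r * (r * r) * ⟦ yes valid ×-dec merges σ ⟧)
        ≤⟨ ∑-mono H (λ σ → ≤-trans
             (*-monoʳ-≤ (r * (r * r)) (⟦⟧-mono (yes valid ×-dec merges σ) (merges σ) proj₂))
             (⟦⟧-× (merge? σ v i) (merge? σ v j) (merge? σ v l))) ⟩
      ∑ H (λ σ → weight i (σ i) * (weight j (σ j) * (weight l (σ l) * 1)))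
        ≤⟨ average₃ (λ _ → d) X (rare i) (rare j) (rare l) i<j j<l l<m ⟩
      length X ^ m ≡⟨ length-sequences (λ _ → d) X m ⟨
      length H ∎
      where
      open ≤-Reasoning
      merges : ∀ σ → Dec (Merge σ v i × Merge σ v j × Merge σ v l)
      merges σ = merge? σ v i ×-dec merge? σ v j ×-dec merge? σ v l
      weight : ℕ → (ℕ → Fin r) → ℕ
      weight i f = r * ⟦ collide? (pos i ⟨$⟩ʳ v) (pos i ⟨$⟩ʳ u) f ⟧
      rare : ∀ i → ∑ X (weight i) ≤ length X
      rare i = collision-≢ _ _ λ e →
        v≢u (trans (sym (inverseˡ (pos i))) (trans (cong (pos i ⟨$⟩ˡ_) e) (inverseˡ (pos i))))

    -- Counting the bad events, instead of asking whether one occurs, turns the union bound into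
    -- linearity of sums.
    badness : (ℕ → ℕ → Fin r) → ℕ
    badness σ = sumFin m λ i → sumFin m λ j → sumFin m λ l → sumFin n λ v → ⟦ bad? σ (toℕ i) (toℕ j) (toℕ l) v ⟧

    badness-rare : r * (r * r) * ∑ H badness ≤ m * (m * (m * (n * length H)))
    badness-rare =
      ∑-sumFin≤ m (r * (r * r)) _ H λ i → ∑-sumFin≤ m (r * (r * r)) _ H λ j → ∑-sumFin≤ m (r * (r * r)) _ H λ l → ∑-sumFin≤ n (r * (r * r)) _ H λ v →
      bad-rare (toℕ i) (toℕ j) (toℕ l) v (toℕ<n l)

    isolated : ∀ σ → badness σ ≡ 0 → Isolated (hash σ) pos L u
    isolated σ b≡0 i j l i<j j<l l≤L v ci cj cl with v F.≟ u
    ... | yes v≡u = v≡u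
    ... | no v≢u = contradiction (subst (1 ≤_) b≡0 (begin
      1 ≡⟨ ⟦⟧-true (bad? σ i j l v) ((i<j , j<l , v≢u) , ci , cj , cl) ⟨
      ⟦ bad? σ i j l v ⟧ ≤⟨ sumFin≥term (λ v → ⟦ bad? σ i j l v ⟧) v ⟩
      S₃ i j l ≤⟨ sumFin≥term-toℕ (S₃ i j) (s≤s l≤L) ⟩
      S₂ i j ≤⟨ sumFin≥term-toℕ (S₂ i) j<m ⟩
      S₁ i ≤⟨ sumFin≥term-toℕ S₁ (<-trans i<j j<m) ⟩
      badness σ ∎)) λ ()
      where
      open ≤-Reasoning
      j<m : j < m
      j<m = <-trans j<l (s≤s l≤L)
      S₃ : ℕ → ℕ → ℕ → ℕ
      S₃ i j l = sumFin n λ v → ⟦ bad? σ i j l v ⟧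
      S₂ : ℕ → ℕ → ℕ
      S₂ i j = sumFin m λ l → S₃ i j (toℕ l)
      S₁ : ℕ → ℕ
      S₁ i = sumFin m λ j → S₂ i (toℕ j)

-- Errors of a randomized formula as a sum

error : Formula V → (V → Bool) → Bool → ℕ
error f ρ b = if ⌊ eval f ρ Bool.≟ b ⌋ then 0 else 1

errCount-∑ : ∀ (f : Formula V) fs ρ b → errCount (f ∷⁺ fs) ρ b ≡ ∑ (f ∷ fs) (λ g → error g ρ b)
errCount-∑ f [] ρ b = refl
errCount-∑ f (g ∷ fs) ρ b = cong (error f ρ b +_) (errCount-∑ g fs ρ b)

allIn : ∀ {P : Formula V → Set} {f fs} → All P (f ∷ fs) → AllIn P (f ∷⁺ fs)
allIn (p ∷ []) = p , tt
allIn (p ∷ ps@(_ ∷ _)) = p , allIn ps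

error≤1 : ∀ (f : Formula V) ρ b → error f ρ b ≤ 1
error≤1 f ρ b with eval f ρ Bool.≟ b
... | yes _ = z≤n
... | no _ = ≤-refl

error≡0 : ∀ (f : Formula V) ρ b → eval f ρ ≡ b → error f ρ b ≡ 0
error≡0 f ρ b e with eval f ρ Bool.≟ b
... | yes _ = refl
... | no ¬e = ⊥-elim (¬e e)

-- Fibonacci numbers against powers of φ

-- Used twice: to choose t from k, and to take integer K-th roots of n.
bracket : (f : ℕ → ℕ) → (∀ i → f i < f (suc i)) → ∀ n → f 0 ≤ n → ∃ λ i → f i ≤ n × n < f (suc i)
bracket f inc zero f0≤n = 0 , f0≤n , ≤-<-trans z≤n (inc 0)
bracket f inc (suc n) f0≤n with m≤n⇒m<n∨m≡n f0≤n
... | inj₂ f0≡n = 0 , f0≤n , subst (_< f 1) f0≡n (inc 0)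
... | inj₁ (s≤s f0≤n′) with bracket f inc n f0≤n′
...   | i , fi≤n , n<fsi with m≤n⇒m<n∨m≡n n<fsi
...     | inj₁ lt = i , m≤n⇒m≤1+n fi≤n , lt
...     | inj₂ eq = suc i , ≤-reflexive (sym eq) , subst (_< f (suc (suc i))) (sym eq) (inc (suc i))

-- With this shift the sequence dominates φ ^ p and is submultiplicative, so exponents can be
-- compared without real numbers.
fib₂ : ℕ → ℕ
fib₂ p = fib (2 + p)

fib₂-< : ∀ p → fib₂ p < fib₂ (suc p)
fib₂-< p = m<m+n (fib₂ p) (fib-pos p)

fib₂-mono : ∀ {p x} → p ≤ x → fib₂ p ≤ fib₂ x
fib₂-mono {x = x} p≤x with m≤n⇒m<n∨m≡n p≤x
... | inj₂ refl = ≤-refl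
fib₂-mono {x = suc x} p≤x | inj₁ (s≤s p≤x′) = ≤-trans (fib₂-mono p≤x′) (<⇒≤ (fib₂-< x))

fib₂-+ : ∀ a b → fib₂ (a + b) ≤ fib₂ a * fib₂ b
fib₂-+ zero b = ≤-reflexive (sym (*-identityˡ _))
fib₂-+ (suc zero) b = +-monoʳ-≤ (fib₂ b) (≤-trans (m≤m+n _ _) (≤-reflexive (sym (+-identityʳ _))))
fib₂-+ (suc (suc a)) b = ≤-trans (+-mono-≤ (fib₂-+ (suc a) b) (fib₂-+ a b))
  (≤-reflexive (sym (*-distribʳ-+ (fib₂ b) (fib₂ (suc a)) (fib₂ a))))

fib₂-* : ∀ q a → fib₂ (q * a) ≤ fib₂ a ^ q
fib₂-* zero a = ≤-refl
fib₂-* (suc q) a = ≤-trans (fib₂-+ a (q * a)) (*-monoʳ-≤ (fib₂ a) (fib₂-* q a))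

-- The left side is 2 φ ^ p = L p + F p √5 with √5 replaced by 3.
lucas-fib : ∀ p → lucas p + 3 * fib p ≡ 2 * fib₂ p
lucas-fib zero = refl
lucas-fib (suc zero) = refl
lucas-fib (suc (suc p)) = begin
  (lucas (suc p) + lucas p) + 3 * (fib (suc p) + fib p)
    ≡⟨ solve 4 (λ a b c d → (a :+ b) :+ con 3 :* (c :+ d) := (a :+ con 3 :* c) :+ (b :+ con 3 :* d)) refl
         (lucas (suc p)) (lucas p) (fib (suc p)) (fib p) ⟩
  (lucas (suc p) + 3 * fib (suc p)) + (lucas p + 3 * fib p) ≡⟨ cong₂ _+_ (lucas-fib (suc p)) (lucas-fib p) ⟩
  2 * fib₂ (suc p) + 2 * fib₂ p ≡⟨ *-distribˡ-+ 2 (fib₂ (suc p)) (fib₂ p) ⟨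
  2 * fib₂ (suc (suc p)) ∎
  where open +-*-Solver; open ≡-Reasoning

-- √5 < 3 turns K < φ^p into K < F (p + 2).
phiPowGt⇒<fib₂ : ∀ p K → PhiPowGt p K → K < fib₂ p
phiPowGt⇒<fib₂ p K gt = *-cancelˡ-< 2 _ _ (subst (2 * K <_) (lucas-fib p) (go gt))
  where
  go : PhiPowGt p K → 2 * K < lucas p + 3 * fib p
  go (inj₁ lt) = ≤-trans lt (m≤m+n _ _)
  go (inj₂ (L≤2K , sq)) = ≤-trans (≤-reflexive (cong suc (sym (m+[n∸m]≡n L≤2K))))
    (+-monoʳ-< (lucas p) (≰⇒> λ 3F≤ → <-irrefl refl (begin-strict
      (2 * K ∸ lucas p) ^ 2 <⟨ sq ⟩
      5 * fib p ^ 2 ≤⟨ *-monoˡ-≤ (fib p ^ 2) (m≤m+n 5 4) ⟩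
      9 * fib p ^ 2 ≡⟨ solve 1 (λ x → con 9 :* (x :^ 2) := (con 3 :* x) :^ 2) refl (fib p) ⟩
      (3 * fib p) ^ 2 ≤⟨ ^-monoˡ-≤ 2 3F≤ ⟩
      (2 * K ∸ lucas p) ^ 2 ∎)))
    where open ≤-Reasoning; open +-*-Solver

-- This is t ≤ log_φ k, tested against each rational upper approximation p / q.
phiPowGt⇒exponent< : ∀ {t k} → fib₂ t ≤ k → ∀ p q → PhiPowGt p (k ^ q) → q * t < p
phiPowGt⇒exponent< {t} {k} fib≤k p q gt = ≰⇒> λ p≤qt → <-irrefl refl (begin-strict
  k ^ q <⟨ phiPowGt⇒<fib₂ p (k ^ q) gt ⟩
  fib₂ p ≤⟨ fib₂-mono p≤qt ⟩
  fib₂ (q * t) ≤⟨ fib₂-* q t ⟩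
  fib₂ t ^ q ≤⟨ ^-monoˡ-≤ q fib≤k ⟩
  k ^ q ∎)
  where open ≤-Reasoning

-- The origin of c = 5: the exponent (14 + t) / 3 is at most t / 3 + 5.
cube≤⇒sizeBound : ∀ {t k n s} → fib₂ t ≤ k → 1 ≤ n → s ^ 3 ≤ n ^ (14 + t) → SizeBound 5 k n s
cube≤⇒sizeBound {t} {k} {n} {s} fib≤k 1≤n s³≤ p q _ gt = begin
  s ^ (3 * q) ≡⟨ ^-*-assoc s 3 q ⟨
  (s ^ 3) ^ q ≤⟨ ^-monoˡ-≤ q s³≤ ⟩
  (n ^ (14 + t)) ^ q ≡⟨ ^-*-assoc n (14 + t) q ⟩
  n ^ ((14 + t) * q) ≤⟨ ^-monoʳ-≤ n {{>-nonZero 1≤n}} (begin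
    (14 + t) * q ≡⟨ solve 2 (λ t q → (con 14 :+ t) :* q := q :* t :+ con 14 :* q) refl t q ⟩
    q * t + 14 * q ≤⟨ +-mono-≤ (<⇒≤ (phiPowGt⇒exponent< fib≤k p q gt)) (*-monoˡ-≤ q (n≤1+n 14)) ⟩
    p + 15 * q ∎) ⟩
  n ^ (p + 3 * 5 * q) ∎
  where open ≤-Reasoning; open +-*-Solver

-- Choice of parameters and assembly

^-distribʳ-* : ∀ e m n → (m * n) ^ e ≡ m ^ e * n ^ e
^-distribʳ-* zero m n = refl
^-distribʳ-* (suc e) m n = trans (cong (m * n *_) (^-distribʳ-* e m n)) ([m*n]*[o*p]≡[m*o]*[n*p] m n (m ^ e) (n ^ e))

funToFin-cong : ∀ {m n} (f g : Fin m → Fin n) → (∀ i → f i ≡ g i) → funToFin f ≡ funToFin g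
funToFin-cong {zero} f g e = refl
funToFin-cong {suc m} f g e = cong₂ combine (e zero) (funToFin-cong (f ∘ suc) (g ∘ suc) (e ∘ suc))

-- Large enough that one factor n absorbs all constants of the size bound.
threshold : ℕ → ℕ
threshold t = ((18 * (3 * suc t)) ^ suc t * 8) ^ 3 * (2 ^ (3 * suc t)) ^ (4 + t)

module Random (k t n g : ℕ) (k≤L : k ≤ fib (3 + t) + 0)
  (g^K≤n : g ^ (3 * suc t) ≤ n) (n<D^K : n < suc g ^ (3 * suc t)) where

  -- `g` is the K-th root of n rounded down. Thus n < D ^ K makes K digits enough to encode a
  -- vertex, while g ^ K ≤ n keeps D ^ K within a constant factor of n. With exponent 1 + t, r³
  -- would be D ^ K, leaving no surplus for the error.
  K D r L : ℕ
  K = 3 * suc t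
  D = suc g
  r = D ^ (2 + t)
  L = fib (3 + t) + 0

  1≤r : 1 ≤ r
  1≤r = m^n>0 D (2 + t)

  r₀ : Fin r
  r₀ = fromℕ< 1≤r

  code : Fin n → Fin K → Fin D
  code u = finToFun (inject≤ u (<⇒≤ n<D^K))

  code-injective : ∀ u v → (∀ s → code u s ≡ code v s) → u ≡ v
  code-injective u v e = inject≤-injective _ _ u v (trans (sym (funToFin-finToFin {K} {D} (inject≤ u _)))
    (trans (funToFin-cong (code u) (code v) e) (funToFin-finToFin {K} {D} (inject≤ v _))))

  Var : Set
  Var = Fin k × Fin n × Fin n

  entry : Fin k → Fin n → Fin n → Var
  entry t i j = t , i , j

  formula : Fin n → Fin n → (ℕ → ℕ → Fin r) → Formula Var
  formula a b σ = Construction.root code (padEdge k entry) (hash σ) t a b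

  formula-depth : ∀ a b σ → depth (formula a b σ) ≤ suc t * 7 + 6
  formula-depth a b σ = root-depth code (padEdge k entry) (hash σ) (padEdge-depth k entry) t a b

  -- Cubing clears the exponent 1 / 3. In 14 + t, the base nodes give 9, the powers of D give 4 + t,
  -- and 1 absorbs the constants.
  formula-size³ : 1 ≤ n → threshold t ≤ n → ∀ a b σ → size (formula a b σ) ^ 3 ≤ n ^ (14 + t)
  formula-size³ 1≤n C≤n a b σ = begin
    size (formula a b σ) ^ 3
      ≤⟨ ^-monoˡ-≤ 3 (root-size code (padEdge k entry) (hash σ) (padEdge-size k entry) t a b 1≤n 1≤r 1≤suc 1≤suc) ⟩
    ((18 * (r * (K * (D * D)))) ^ T * (8 * n ^ 3)) ^ 3
      ≡⟨ cong (λ x → (x ^ T * (8 * n ^ 3)) ^ 3)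
           (solve 3 (λ r K D → con 18 :* (r :* (K :* (D :* D))) := con 18 :* K :* (D :* (D :* r))) refl r K D) ⟩
    ((18 * K * D ^ (4 + t)) ^ T * (8 * n ^ 3)) ^ 3
      ≡⟨ cong (λ x → (x * (8 * n ^ 3)) ^ 3) (^-distribʳ-* T (18 * K) (D ^ (4 + t))) ⟩
    ((18 * K) ^ T * (D ^ (4 + t)) ^ T * (8 * n ^ 3)) ^ 3
      ≡⟨ solve 3 (λ X Y n → (X :* Y :* (con 8 :* n :^ 3)) :^ 3 := (X :* con 8) :^ 3 :* Y :^ 3 :* n :^ 9) refl
           ((18 * K) ^ T) ((D ^ (4 + t)) ^ T) n ⟩
    ((18 * K) ^ T * 8) ^ 3 * ((D ^ (4 + t)) ^ T) ^ 3 * n ^ 9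
      ≡⟨ cong (λ x → ((18 * K) ^ T * 8) ^ 3 * x * n ^ 9) powers ⟩
    ((18 * K) ^ T * 8) ^ 3 * (D ^ K) ^ (4 + t) * n ^ 9
      ≤⟨ *-monoˡ-≤ (n ^ 9) (*-monoʳ-≤ (((18 * K) ^ T * 8) ^ 3) (^-monoˡ-≤ (4 + t) D^K≤)) ⟩
    ((18 * K) ^ T * 8) ^ 3 * (2 ^ K * n) ^ (4 + t) * n ^ 9
      ≡⟨ cong (λ x → ((18 * K) ^ T * 8) ^ 3 * x * n ^ 9) (^-distribʳ-* (4 + t) (2 ^ K) n) ⟩
    ((18 * K) ^ T * 8) ^ 3 * ((2 ^ K) ^ (4 + t) * n ^ (4 + t)) * n ^ 9
      ≡⟨ cong (_* n ^ 9) (*-assoc (((18 * K) ^ T * 8) ^ 3) ((2 ^ K) ^ (4 + t)) (n ^ (4 + t))) ⟨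
    threshold t * n ^ (4 + t) * n ^ 9
      ≤⟨ *-monoˡ-≤ (n ^ 9) (*-monoˡ-≤ (n ^ (4 + t)) C≤n) ⟩
    n ^ (5 + t) * n ^ 9
      ≡⟨ *-comm (n ^ (5 + t)) (n ^ 9) ⟩
    n ^ 9 * n ^ (5 + t)
      ≡⟨ ^-distribˡ-+-* n 9 (5 + t) ⟨
    n ^ (14 + t) ∎
    where
    open ≤-Reasoning
    open +-*-Solver
    T = suc t
    powers : ((D ^ (4 + t)) ^ T) ^ 3 ≡ (D ^ K) ^ (4 + t)
    powers = trans (cong (_^ 3) (^-*-assoc D (4 + t) T)) (trans (^-*-assoc D ((4 + t) * T) 3)
      (trans (cong (D ^_) (solve 1 (λ t → (con 4 :+ t) :* (con 1 :+ t) :* con 3 := con 3 :* (con 1 :+ t) :* (con 4 :+ t)) refl t))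
        (sym (^-*-assoc D K (4 + t)))))
    -- Since n ≥ 1, the root `g` is positive and so D = g + 1 ≤ 2 g.
    1≤g : ∀ g → n < suc g ^ K → 1 ≤ g
    1≤g zero n< = ⊥-elim (<⇒≱ (subst (n <_) (^-zeroˡ K) n<) 1≤n)
    1≤g (suc g) _ = 1≤suc
    D^K≤ : D ^ K ≤ 2 ^ K * n
    D^K≤ = ≤-trans (^-monoˡ-≤ K {D} {2 * g} (suc-scale 1 (1≤g g n<D^K) (≤-reflexive (sym (*-identityˡ g)))))
      (≤-trans (≤-reflexive (^-distribʳ-* K 2 g)) (*-monoʳ-≤ (2 ^ K) g^K≤n))

  H : List (ℕ → ℕ → Fin r)
  H = seeds r₀ n (suc L)

  random : Fin n → Fin n → List (ℕ → ℕ → Fin r) → RandFormula Var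
  random a b [] = ∧g [] ∷⁺ []
  random a b (σ ∷ σs) = formula a b σ ∷⁺ map (formula a b) σs

  module _ (Q : Fin k → BMat n) (perm : ∀ i → IsPermMatrix (Q i)) where

    pos : ℕ → Permutation′ n
    pos = compose (pad k (λ i → proj₁ (perm i)))

    product-pos : ∀ a b → productEntry k Q a b ≡ ⌊ (pos L ⟨$⟩ʳ a) F.≟ b ⌋
    product-pos a b = trans (cong (ℕ._≡ᵇ 1) (prodMats-perm k Q _ (λ i → proj₂ (perm i)) L k≤L a b)) (b2n-≡ᵇ1 _)

    formula-correct : ∀ a b σ → Isolated (hash σ) pos L a →
      eval (formula a b σ) (inputOf Q) ≡ productEntry k Q a b
    formula-correct a b σ iso = trans
      (det (Construction.Semantics.root-reflects code (padEdge k entry) (hash σ) zero code-injective pos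
              (λ i u v → padEdge-reflects k entry _ (λ t → proj₂ (perm t)) i (pos i ⟨$⟩ʳ u) v) t a b iso)
           (isYes-reflects ((pos L ⟨$⟩ʳ a) F.≟ b)))
      (sym (product-pos a b))

    -- Markov's inequality pointwise: an error indicator is at most 1, and badness 0 means
    -- isolation, hence a correct output.
    error≤badness : ∀ a b σ → error (formula a b σ) (inputOf Q) (productEntry k Q a b) ≤ badness r₀ pos L a σ
    error≤badness a b σ with badness r₀ pos L a σ in eq
    ... | zero = ≤-reflexive (error≡0 (formula a b σ) _ _ (formula-correct a b σ (isolated r₀ pos L a σ eq)))
    ... | suc _ = ≤-trans (error≤1 (formula a b σ) _ _) 1≤suc

    error-bound : ∀ M → (suc L * (suc L * suc L)) * suc M ≤ D → ∀ a b σs →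
      r * (r * r) * ∑ σs (badness r₀ pos L a) ≤ suc L * (suc L * (suc L * (n * length σs))) →
      1 ≤ length σs →
      errCount (random a b σs) (inputOf Q) (productEntry k Q a b) * suc M ≤ length (toList (random a b σs))
    error-bound M M≤D a b (σ ∷ σs) rare _ = *-cancelˡ-≤ (r * (r * r)) {{>-nonZero (1≤* 1≤r (1≤* 1≤r 1≤r))}} (begin
      R * (errCount (random a b (σ ∷ σs)) ρ w * suc M)
        ≡⟨ cong (λ x → R * (x * suc M)) (trans (errCount-∑ (formula a b σ) (map (formula a b) σs) ρ w)
             (∑-map (formula a b) (σ ∷ σs) (λ f → error f ρ w))) ⟩
      R * (∑ (σ ∷ σs) (λ σ → error (formula a b σ) ρ w) * suc M)
        ≤⟨ *-monoʳ-≤ R (*-monoˡ-≤ (suc M) (∑-mono (σ ∷ σs) (error≤badness a b))) ⟩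
      R * (∑ (σ ∷ σs) (badness r₀ pos L a) * suc M)
        ≡⟨ *-assoc R _ (suc M) ⟨
      R * ∑ (σ ∷ σs) (badness r₀ pos L a) * suc M
        ≤⟨ *-monoˡ-≤ (suc M) rare ⟩
      m * (m * (m * (n * ℓ))) * suc M
        ≡⟨ solve 4 (λ m n ℓ M → m :* (m :* (m :* (n :* ℓ))) :* M := (m :* (m :* m)) :* M :* n :* ℓ) refl m n ℓ (suc M) ⟩
      (m * (m * m)) * suc M * n * ℓ
        -- One factor D pays for the number of triples of layers and for the accuracy M + 1; D ^ K
        -- pays for the n competing paths.
        ≤⟨ *-monoˡ-≤ ℓ (*-mono-≤ M≤D (<⇒≤ n<D^K)) ⟩
      D * D ^ K * ℓ
        ≤⟨ *-monoˡ-≤ ℓ D^K+1≤R ⟩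
      R * ℓ
        ≡⟨ cong (λ x → R * suc x) (length-map (formula a b) σs) ⟨
      R * length (toList (random a b (σ ∷ σs))) ∎)
      where
      open ≤-Reasoning
      open +-*-Solver
      R m ℓ : ℕ
      R = r * (r * r)
      m = suc L
      ℓ = length (σ ∷ σs)
      ρ = inputOf Q
      w = productEntry k Q a b
      D^K+1≤R : D * D ^ K ≤ R
      D^K+1≤R = begin
        D ^ suc K ≤⟨ ^-monoʳ-≤ D (m≤n+m (suc K) 2) ⟩
        D ^ (3 + K) ≡⟨ cong (D ^_) (solve 1 (λ t → con 3 :+ con 3 :* (con 1 :+ t) :=
             (con 2 :+ t) :+ ((con 2 :+ t) :+ (con 2 :+ t))) refl t) ⟩
        D ^ ((2 + t) + ((2 + t) + (2 + t))) ≡⟨ ^-distribˡ-+-* D (2 + t) ((2 + t) + (2 + t)) ⟩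
        r * D ^ ((2 + t) + (2 + t)) ≡⟨ cong (r *_) (^-distribˡ-+-* D (2 + t) (2 + t)) ⟩
        R ∎

    random-error : ∀ M → ((suc L * (suc L * suc L)) * suc M) ^ K ≤ n → ∀ a b →
      errCount (random a b H) (inputOf Q) (productEntry k Q a b) * suc M ≤ length (toList (random a b H))
    random-error M M^K≤n a b = error-bound M
      -- Comparing K-th powers: n < D ^ K forces D to reach the required value once n is at least
      -- its K-th power.
      (≮⇒≥ λ D<M → <-irrefl refl (<-≤-trans n<D^K (≤-trans (^-monoˡ-≤ K (<⇒≤ D<M)) M^K≤n)))
      a b H (badness-rare r₀ pos L a)
      (subst (1 ≤_) (sym (trans (length-sequences (λ _ → r₀) X (suc L)) (cong (_^ suc L)
        (length-sequences r₀ (allFin r) n))))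
        (^-pos (^-pos (subst (1 ≤_) (sym (length-tabulate {n = r} (λ x → x))) 1≤r) n) (suc L)))
      where
      X = sequences r₀ (allFin r) n
      ^-pos : ∀ {x} → 1 ≤ x → ∀ e → 1 ≤ x ^ e
      ^-pos 1≤x zero = ≤-refl
      ^-pos 1≤x (suc e) = 1≤* 1≤x (^-pos 1≤x e)

root-bracket : ∀ t n → ∃ λ g → g ^ (3 * suc t) ≤ n × n < suc g ^ (3 * suc t)
root-bracket t n = bracket (_^ (3 * suc t)) (λ g → ^-monoˡ-< (3 * suc t) (n<1+n g)) n z≤n

-- Below the threshold the constants cannot be absorbed into n, so a one-gate formula is used; the
-- error claim is asymptotic and permits this. The decision is an argument so that proofs can split
-- on it.
family : ∀ k t → k ≤ fib (3 + t) + 0 → ∀ n → Dec (n < threshold t) →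
  Fin n → Fin n → RandFormula (Fin k × Fin n × Fin n)
family k t k≤L n (yes _) a b = ∧g [] ∷⁺ []
family k t k≤L n (no _) a b = random a b H
  where open Random k t n _ k≤L (proj₁ (proj₂ (root-bracket t n))) (proj₂ (proj₂ (root-bracket t n)))

pos-dim : ∀ {n} → Fin n → 1 ≤ n
pos-dim zero = 1≤suc
pos-dim (suc _) = 1≤suc

family-bounds : ∀ k t (k≤L : k ≤ fib (3 + t) + 0) → fib₂ t ≤ k → ∀ n n? a b →
  AllIn (λ f → (depth f ≤ suc t * 7 + 6) × SizeBound 5 k n (size f)) (family k t k≤L n n? a b)
family-bounds k t k≤L fib≤k n n? a b = go n?
  where
  open Random k t n _ k≤L (proj₁ (proj₂ (root-bracket t n))) (proj₂ (proj₂ (root-bracket t n)))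
  Good : Formula Var → Set
  Good f = (depth f ≤ suc t * 7 + 6) × SizeBound 5 k n (size f)
  trivial : Good (∧g [])
  trivial = 1≤suc , cube≤⇒sizeBound {t} fib≤k (pos-dim a) (m^n>0 n {{>-nonZero (pos-dim a)}} (14 + t))
  good : threshold t ≤ n → ∀ σ → Good (formula a b σ)
  good C≤n σ = formula-depth a b σ , cube≤⇒sizeBound {t} fib≤k (pos-dim a) (formula-size³ (pos-dim a) C≤n a b σ)
  all-good : threshold t ≤ n → ∀ σs → AllIn Good (random a b σs)
  all-good C≤n [] = trivial , tt
  all-good C≤n (σ ∷ σs) = allIn {P = Good} {f = formula a b σ} {fs = map (formula a b) σs} (good C≤n σ ∷ map⁺ (All.universal (good C≤n) σs))
  go : ∀ n? → AllIn Good (family k t k≤L n n? a b)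
  go (yes _) = trivial , tt
  go (no n≮) = all-good (≮⇒≥ n≮) H

family-error : ∀ k t (k≤L : k ≤ fib (3 + t) + 0) M → let m = suc (fib (3 + t) + 0) in
  ∀ n n? → threshold t + (m * (m * m) * suc M) ^ (3 * suc t) ≤ n →
  ∀ Q → (∀ i → IsPermMatrix (Q i)) → ∀ a b → let F = family k t k≤L n n? a b in
  errCount F (inputOf Q) (productEntry k Q a b) * suc M ≤ length (toList F)
family-error k t k≤L M n (yes n<C) N≤n Q perm a b = ⊥-elim (<⇒≱ n<C (≤-trans (m≤m+n _ _) N≤n))
family-error k t k≤L M n (no _) N≤n Q perm a b = random-error Q perm M (≤-trans (m≤n+m _ (threshold t)) N≤n) a b
  where open Random k t n _ k≤L (proj₁ (proj₂ (root-bracket t n))) (proj₂ (proj₂ (root-bracket t n)))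

theorem1p10 : ∃ λ (c : ℕ) → ∀ (k : ℕ) → 1 ≤ k →
    ∃ λ (d : ℕ) →
    ∃ λ (F : (n : ℕ) → Fin n → Fin n → RandFormula (Fin k × Fin n × Fin n)) →
    (∀ n (a b : Fin n) →
    AllIn (λ f → (depth f ≤ d) × SizeBound c k n (size f)) (F n a b))
    ×
    (∀ (m : ℕ) → ∃ λ (N : ℕ) → ∀ n → N ≤ n →
    ∀ (Q : Fin k → BMat n) → (∀ t → IsPermMatrix (Q t)) →
    ∀ (a b : Fin n) →
    errCount (F n a b) (inputOf Q) (productEntry k Q a b) * suc m ≤ length (toList (F n a b)))
theorem1p10 = 5 , λ k 1≤k →
  -- F (t + 2) ≤ k bounds the size exponent by log_φ k, and k < F (t + 3) leaves room for all k
  -- matrices.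
  let t , fib≤k , k<fib = bracket fib₂ fib₂-< k 1≤k
      k≤L = ≤-trans (<⇒≤ k<fib) (m≤m+n (fib (3 + t)) 0)
  in suc t * 7 + 6 , (λ n → family k t k≤L n (n <? threshold t)) ,
     (λ n → family-bounds k t k≤L fib≤k n (n <? threshold t)) ,
     λ M → _ , λ n → family-error k t k≤L M n (n <? threshold t)
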